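{- Let $m,n\ge 3$ be integers, let $k\in\mathbb{Z}_n^{\times}$ with $k^m\equiv 1 \pmod n$, let $\alpha$ be the order of $k$ in $\mathbb{Z}_n^{\times}$, and let $t=m/\alpha$. Let $A=(A_{ij})_{0\le i,j\le n-1}$ be the adjacency matrix of the Cayley graph $\mathcal{T}_{m,n,k}$ with respect to the packet ordering of the vertices, divided into $m\times m$ blocks $A_{ij}$ (rows indexed by the packet $V_i$, columns by the packet $V_j$). Then $A$ is block-circulant (i.e. $A_{ij}=A_{i+1,j+1}$ with block indices read modulo $n$), $A_{ii}=A(C_m)$ for each $i$, where $A(C_m)$ is the adjacency matrix of the $m$-cycle graph $C_m$ with its vertices $0,1,\dots,m-1$ in cyclic order, and for each $j\ne i$ the block $A_{ij}$ is a diagonal matrix with $0$, $t$ or $2t$ nonzero entries, given as follows. (i) If $k^s\not\equiv -1\pmod n$ for every $s$, then $$A_{ij}=\begin{cases}\mathrm{Diag}_m(\xi,\xi+\alpha,\dots,\xi+(t-1)\alpha), & \text{if } j\equiv i\pm k^{\alpha-\xi}\pmod n \text{ for some } 0\le\xi\le\alpha-1,\\ \Theta, & \text{otherwise.}\end{cases}$$ (ii) If $\alpha$ is even and $k^{\alpha/2}\equiv -1\pmod n$, then $$A_{ij}=\begin{cases}\mathrm{Diag}_m\left(\xi,\xi+\tfrac{\alpha}{2},\dots,\xi+(2t-1)\tfrac{\alpha}{2}\right), & \text{if } j\equiv i\pm k^{\alpha-\xi}\pmod n\text{ for some } 0\le\xi\le\tfrac{\alpha}{2}-1,\\ \Theta,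 & \text{otherwise.}\end{cases}$$
   Context: The group $\mathbb{Z}_m\ltimes_k\mathbb{Z}_n$ is $\langle x,y : x^m=1=y^n,\ x^{ -1}yx=y^k\rangle$, of order $mn$; every element is uniquely $x^ay^b$ with $a\in\mathbb{Z}_m$, $b\in\mathbb{Z}_n$. The graph $\mathcal{T}_{m,n,k}$ is the undirected Cayley graph of this group with respect to $\{x^{\pm1},y^{\pm1}\}$ (written $\{(\pm1,0),(0,\pm1)\}$ in coordinates): $v_1,v_2$ are adjacent iff $v_2=v_1x^{\pm1}$ or $v_2=v_1y^{\pm1}$. Packets: for $i\in\{0,\dots,n-1\}$, $V_i=\{x^{\tau\alpha+\xi}y^{ik^{\xi}} : 0\le\tau\le t-1,\ 0\le\xi\le\alpha-1\}$. The $V_i$ partition the vertex set and $|V_i|=m$. Packet ordering: within $V_i$, $x^{\tau\alpha+\xi}y^{ik^{\xi}}<x^{\tau'\alpha+\xi'}y^{ik^{\xi'}}$ iff $\tau<\tau'$, or $\tau=\tau'$ and $\xi<\xi'$; for $i\neq j$, every vertex of $V_i$ precedes every vertex of $V_j$ iff $i<j$. Thus the vertex $x^{\tau\alpha+\xi}y^{ik^\xi}$ has position $\tau\alpha+\xi\in\{0,\dots,m-1\}$ in $V_i$. $\mathrm{Diag}_m(p_1,\dots,p_r)$ is the $m\times m$ diagonal matrix, rows and columns indexed by $0,\dots,m-1$, with diagonal entry $1$ at the positions $p_1,\dots,p_r$ and $0$ elsewhere. $\Theta$ is the zero matrix. -}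

module Defs where

open import Algebra.Bundles using (Group)
open import Data.Bool.Base using (if_then_else_)
open import Data.Fin.Base as Fin using (Fin; toℕ; combine; remQuot)
open import Data.Integer.Base as ℤ using (ℤ; 1ℤ)
open import Data.Integer.Divisibility as ℤ using ()
import Data.Fin.Properties as Fin
import Data.Integer.Properties as ℤ
open import Data.List.Base using (List; []; _∷_; length; filter; allFin; cartesianProduct)
open import Data.List.Relation.Unary.Any using (Any; any?)
open import Data.Nat.Base
open import Data.Nat.DivMod
import Data.Nat.Divisibility as ℕ
open import Data.Nat.Properties
open import Data.Nat.Solver using (module +-*-Solver)
open import Data.List.Membership.DecPropositional _≟_ using (_∈_; _∈?_)
open import Data.Product using (_×_; _,_; proj₁; proj₂; uncurry)
open import Data.Sum.Base using (_⊎_; inj₁; inj₂)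
open import Level using (0ℓ)
open import Relation.Binary.Core using (Rel)
open import Relation.Binary.Definitions using (Decidable)
open import Relation.Binary.PropositionalEquality
  using (_≡_; _≢_; refl; sym; trans; cong; cong₂; subst; module ≡-Reasoning)
import Relation.Binary.Reasoning.Setoid as SetoidReasoning
open import Relation.Nullary using (does; _×-dec_; _⊎-dec_; ¬?)
import Relation.Nullary.Decidable as Dec

infix 4 _≡_[mod_] _≡_±_[mod_]

_≡_[mod_] : ℤ → ℤ → ℕ → Set
a ≡ b [mod n ] = ℤ.+ n ℤ.∣ a ℤ.- b

_≡_±_[mod_] : ℤ → ℤ → ℤ → ℕ → Set
a ≡ b ± c [mod n ] = a ≡ b ℤ.+ c [mod n ] ⊎ a ≡ b ℤ.- c [mod n ]

record IsMultiplicativeOrder (n k α : ℕ) : Set where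
  field
    positive : 0 < α
    k^α≡1    : ℤ.+ (k ^ α) ≡ 1ℤ [mod n ]
    minimal  : ∀ d → 0 < d → ℤ.+ (k ^ d) ≡ 1ℤ [mod n ] → α ≤ d

infixl 7 _∙_
infix  8 _⁻¹

data Term (X : Set) : Set where
  gen : X → Term X
  ε   : Term X
  _∙_ : Term X → Term X → Term X
  _⁻¹ : Term X → Term X

infixr 9 _^ᵗ_

_^ᵗ_ : ∀ {X} → Term X → ℕ → Term X
u ^ᵗ zero  = ε
u ^ᵗ suc a = u ∙ u ^ᵗ a

module Presentation {X : Set} (R : Rel (Term X) 0ℓ) where

  infix 4 _≈_

  data _≈_ : Rel (Term X) 0ℓ where
    relator   : ∀ {u v} → R u v → u ≈ v
    ≈-refl    : ∀ {u} → u ≈ u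
    ≈-sym     : ∀ {u v} → u ≈ v → v ≈ u
    ≈-trans   : ∀ {u v w} → u ≈ v → v ≈ w → u ≈ w
    ∙-cong    : ∀ {u u′ v v′} → u ≈ u′ → v ≈ v′ → u ∙ v ≈ u′ ∙ v′
    ⁻¹-cong   : ∀ {u v} → u ≈ v → u ⁻¹ ≈ v ⁻¹
    assoc     : ∀ u v w → (u ∙ v) ∙ w ≈ u ∙ (v ∙ w)
    identityˡ : ∀ u → ε ∙ u ≈ u
    identityʳ : ∀ u → u ∙ ε ≈ u
    inverseˡ  : ∀ u → u ⁻¹ ∙ u ≈ ε
    inverseʳ  : ∀ u → u ∙ u ⁻¹ ≈ ε

  group : Group 0ℓ 0ℓ
  group = record
    { Carrier = Term X
    ; _≈_     = _≈_
    ; _∙_     = _∙_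
    ; ε       = ε
    ; _⁻¹     = _⁻¹
    ; isGroup = record
      { isMonoid = record
        { isSemigroup = record
          { isMagma = record
            { isEquivalence = record
              { refl = ≈-refl ; sym = ≈-sym ; trans = ≈-trans }
            ; ∙-cong = ∙-cong
            }
          ; assoc = assoc
          }
        ; identity = identityˡ , identityʳ
        }
      ; inverse = inverseˡ , inverseʳ
      ; ⁻¹-cong = ⁻¹-cong
      }
    }

data Generator : Set where
  gx gy : Generator

x y : Term Generator
x = gen gx
y = gen gy

-- Conjugation is on the right: yx = xy^k, so x^a y^b ∙ x^c y^d = x^(a+c) y^(b k^c + d).
data Relator (m n k : ℕ) : Rel (Term Generator) 0ℓ where
  x^m≈ε     : Relator m n k (x ^ᵗ m) ε
  y^n≈ε     : Relator m n k (y ^ᵗ n) ε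
  x⁻¹yx≈y^k : Relator m n k (x ⁻¹ ∙ y ∙ x) (y ^ᵗ k)

ℤ_⋉[_]ℤ_ : ℕ → ℕ → ℕ → Group 0ℓ 0ℓ
ℤ m ⋉[ k ]ℤ n = Presentation.group (Relator m n k)

-- The word problem: a term is sent to exponents (a , b) with term ≈ x^a y^b,
-- and two terms are equal in the group iff their exponents agree modulo m and n.
module WordProblem (m n k : ℕ) .{{_ : NonZero m}} .{{_ : NonZero n}}
                   (k^m≡1 : ℤ.+ (k ^ m) ≡ 1ℤ [mod n ]) where

  open Presentation (Relator m n k)
  open Group group using (setoid)
  open import Algebra.Properties.Group group using (inverseˡ-unique)

  private
    infix 4 _∼[_]_
    _∼[_]_ : ℕ → (d : ℕ) .{{_ : NonZero d}} → ℕ → Set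
    a ∼[ d ] b = a % d ≡ b % d

    ∼-+ : ∀ d .{{_ : NonZero d}} {a a′ b b′} →
          a ∼[ d ] a′ → b ∼[ d ] b′ → a + b ∼[ d ] a′ + b′
    ∼-+ d {a} {a′} {b} {b′} p q = begin
      (a + b) % d             ≡⟨ %-distribˡ-+ a b d ⟩
      (a % d + b % d) % d     ≡⟨ cong (_% d) (cong₂ _+_ p q) ⟩
      (a′ % d + b′ % d) % d   ≡⟨ %-distribˡ-+ a′ b′ d ⟨
      (a′ + b′) % d           ∎
      where open ≡-Reasoning

    ∼-* : ∀ d .{{_ : NonZero d}} {a a′ b b′} →
          a ∼[ d ] a′ → b ∼[ d ] b′ → a * b ∼[ d ] a′ * b′
    ∼-* d {a} {a′} {b} {b′} p q = begin
      (a * b) % d               ≡⟨ %-distribˡ-* a b d ⟩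
      ((a % d) * (b % d)) % d   ≡⟨ cong (_% d) (cong₂ _*_ p q) ⟩
      ((a′ % d) * (b′ % d)) % d ≡⟨ %-distribˡ-* a′ b′ d ⟨
      (a′ * b′) % d             ∎
      where open ≡-Reasoning

    d*a∼0 : ∀ d .{{_ : NonZero d}} a → d * a ∼[ d ] 0
    d*a∼0 d a = begin
      (d * a) % d  ≡⟨ cong (_% d) (*-comm d a) ⟩
      (a * d) % d  ≡⟨ m*n%n≡0 a d ⟩
      0            ≡⟨ 0%n≡0 ⟨
      0 % d        ∎
      where
      open ≡-Reasoning
      0%n≡0 : 0 % d ≡ 0
      0%n≡0 = m*n%n≡0 0 d

    ≤⇒∼ : ∀ {a b} → b ≤ a → n ℕ.∣ a ∸ b → a ∼[ n ] b
    ≤⇒∼ {a} {b} b≤a n∣a-b =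
      trans (cong (_% n) (sym (m+[n∸m]≡n b≤a))) (%-remove-+ʳ b n∣a-b)

    mod⇒∼ : ∀ a b → ℤ.+ a ≡ ℤ.+ b [mod n ] → a ∼[ n ] b
    mod⇒∼ a b n∣a-b with ≤-total b a
    ... | inj₁ b≤a = ≤⇒∼ b≤a
          (subst (λ c → n ℕ.∣ ℤ.∣ c ∣) (trans (ℤ.m-n≡m⊖n a b) (ℤ.⊖-≥ b≤a)) n∣a-b)
    ... | inj₂ a≤b = sym (≤⇒∼ a≤b
          (subst (n ℕ.∣_) (trans (cong ℤ.∣_∣ (trans (ℤ.m-n≡m⊖n a b) (ℤ.⊖-≤ a≤b)))
                                 (ℤ.∣-i∣≡∣i∣ (ℤ.+ (b ∸ a)))) n∣a-b))

    k^m∼1 : k ^ m ∼[ n ] 1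
    k^m∼1 = mod⇒∼ (k ^ m) 1 k^m≡1

    k^qm∼1 : ∀ q → k ^ (q * m) ∼[ n ] 1
    k^qm∼1 zero    = refl
    k^qm∼1 (suc q) = trans (cong (_% n) (^-distribˡ-+-* k m (q * m)))
                           (∼-* n k^m∼1 (k^qm∼1 q))

    k^-reduce : ∀ a → k ^ a ∼[ n ] k ^ (a % m)
    k^-reduce a = begin
      k ^ a % n                                ≡⟨ cong (λ c → k ^ c % n) (m≡m%n+[m/n]*n a m) ⟩
      k ^ (a % m + a / m * m) % n              ≡⟨ cong (_% n) (^-distribˡ-+-* k (a % m) _) ⟩
      (k ^ (a % m) * k ^ (a / m * m)) % n      ≡⟨ ∼-* n {k ^ (a % m)} refl (k^qm∼1 (a / m)) ⟩
      (k ^ (a % m) * 1) % n                    ≡⟨ cong (_% n) (*-identityʳ _) ⟩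
      k ^ (a % m) % n                          ∎
      where open ≡-Reasoning

    k^-cong : ∀ {a a′} → a ∼[ m ] a′ → k ^ a ∼[ n ] k ^ a′
    k^-cong {a} {a′} p =
      trans (k^-reduce a) (trans (cong (λ c → k ^ c % n) p) (sym (k^-reduce a′)))

    k^ma∼1 : ∀ a → k ^ (m * a) ∼[ n ] 1
    k^ma∼1 a = trans (cong (λ c → k ^ c % n) (*-comm m a)) (k^qm∼1 a)

    pred+1 : ∀ d .{{_ : NonZero d}} a → pred d * a + a ≡ d * a
    pred+1 d a = trans (+-comm (pred d * a) a) (cong (_* a) (suc-pred d))

  exponents : Term Generator → ℕ × ℕ
  exponents (gen gx) = 1 , 0
  exponents (gen gy) = 0 , 1
  exponents ε        = 0 , 0
  exponents (u ∙ v)  = let (a , b) = exponents u ; (c , d) = exponents v in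
                       a + c , b * k ^ c + d
  exponents (u ⁻¹)   = let (a , b) = exponents u in
                       pred m * a , pred n * b * k ^ (pred m * a)

  private
    exponents-x^ : ∀ a → exponents (x ^ᵗ a) ≡ (a , 0)
    exponents-x^ zero    = refl
    exponents-x^ (suc a) rewrite exponents-x^ a = refl

    exponents-y^ : ∀ b → exponents (y ^ᵗ b) ≡ (0 , b)
    exponents-y^ zero    = refl
    exponents-y^ (suc b) rewrite exponents-y^ b = refl

  infix 4 _≋_
  _≋_ : Rel (ℕ × ℕ) 0ℓ
  (a , b) ≋ (c , d) = a % m ≡ c % m × b % n ≡ d % n

  private
    open +-*-Solver

    exponents-relator : ∀ {u v} → Relator m n k u v → exponents u ≋ exponents v
    exponents-relator x^m≈ε rewrite exponents-x^ m =
      trans (n%n≡0 m) (sym (m*n%n≡0 0 m)) , refl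
    exponents-relator y^n≈ε rewrite exponents-y^ n =
      refl , trans (n%n≡0 n) (sym (m*n%n≡0 0 n))
    exponents-relator x⁻¹yx≈y^k rewrite exponents-y^ k =
      trans (cong (_% m) (trans (cong (_+ 1) (+-identityʳ (pred m * 1)))
                                (pred+1 m 1)))
            (d*a∼0 m 1) ,
      cong (_% n)
        (trans (cong (λ c → (c * k ^ (pred m * 1) * 1 + 1) * (k * 1) + 0)
                     (*-zeroʳ (pred n)))
               (solve 1 (λ κ → (con 1) :* (κ :* con 1) :+ con 0 := κ) refl k))

  exponents-cong : ∀ {u v} → u ≈ v → exponents u ≋ exponents v
  exponents-cong (relator r)   = exponents-relator r
  exponents-cong ≈-refl        = refl , refl
  exponents-cong (≈-sym p)     = let (q , r) = exponents-cong p in sym q , sym r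
  exponents-cong (≈-trans p q) =
    let (p₁ , p₂) = exponents-cong p ; (q₁ , q₂) = exponents-cong q in
    trans p₁ q₁ , trans p₂ q₂
  exponents-cong (∙-cong {u} {u′} {v} {v′} p q) =
    let (p₁ , p₂) = exponents-cong p ; (q₁ , q₂) = exponents-cong q
        (a , b) = exponents u ; (a′ , b′) = exponents u′
        (c , d) = exponents v ; (c′ , d′) = exponents v′ in
    ∼-+ m {a} {a′} p₁ q₁ ,
    ∼-+ n {b * k ^ c} {b′ * k ^ c′} (∼-* n {b} {b′} p₂ (k^-cong q₁)) q₂
  exponents-cong (⁻¹-cong {u} {v} p) =
    let (p₁ , p₂) = exponents-cong p
        (a , b) = exponents u ; (c , d) = exponents v
        q = ∼-* m {pred m} refl p₁ in
    q , ∼-* n {pred n * b} {pred n * d} (∼-* n {pred n} refl p₂) (k^-cong q)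
  exponents-cong (assoc u v w) =
    let (a , b) = exponents u ; (c , d) = exponents v ; (e , f) = exponents w in
    cong (_% m) (+-assoc a c e) ,
    cong (_% n) (trans
      (solve 5 (λ b κ d λ′ f → (b :* κ :+ d) :* λ′ :+ f := b :* (κ :* λ′) :+ (d :* λ′ :+ f))
             refl b (k ^ c) d (k ^ e) f)
      (cong (λ z → b * z + (d * k ^ e + f)) (sym (^-distribˡ-+-* k c e))))
  exponents-cong (identityˡ u) = refl , refl
  exponents-cong (identityʳ u) =
    let (a , b) = exponents u in
    cong (_% m) (+-identityʳ a) ,
    cong (_% n) (trans (+-identityʳ (b * 1)) (*-identityʳ b))
  exponents-cong (inverseˡ u) =
    let (a , b) = exponents u ; κ = k ^ (pred m * a) ; λ′ = k ^ a in
    trans (cong (_% m) (pred+1 m a)) (d*a∼0 m a) ,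
    (begin
      (pred n * b * κ * λ′ + b) % n   ≡⟨ cong (λ z → (z + b) % n) (*-assoc (pred n * b) κ λ′) ⟩
      (pred n * b * (κ * λ′) + b) % n
        ≡⟨ ∼-+ n {pred n * b * (κ * λ′)} {pred n * b * 1}
             (∼-* n {pred n * b} refl
               (trans (cong (_% n) (trans (sym (^-distribˡ-+-* k (pred m * a) a))
                                          (cong (k ^_) (pred+1 m a))))
                      (k^ma∼1 a)))
             refl ⟩
      (pred n * b * 1 + b) % n        ≡⟨ cong (λ z → (z + b) % n) (*-identityʳ (pred n * b)) ⟩
      (pred n * b + b) % n            ≡⟨ cong (_% n) (pred+1 n b) ⟩
      (n * b) % n                     ≡⟨ d*a∼0 n b ⟩
      0 % n                           ∎)
    where open ≡-Reasoning
  exponents-cong (inverseʳ u) =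
    let (a , b) = exponents u ; κ = k ^ (pred m * a) in
    trans (cong (_% m) (trans (+-comm a _) (pred+1 m a))) (d*a∼0 m a) ,
    trans (cong (_% n) (trans
            (solve 3 (λ ν b κ → b :* κ :+ ν :* b :* κ := ν :* (b :* κ) :+ b :* κ)
                   refl (pred n) b κ)
            (pred+1 n (b * κ))))
          (d*a∼0 n (b * κ))

  private
    open SetoidReasoning setoid

    ≡⇒≈ : ∀ {u v} → u ≡ v → u ≈ v
    ≡⇒≈ refl = ≈-refl

    ^-+ : ∀ u a b → u ^ᵗ (a + b) ≈ u ^ᵗ a ∙ u ^ᵗ b
    ^-+ u zero    b = ≈-sym (identityˡ _)
    ^-+ u (suc a) b = ≈-trans (∙-cong ≈-refl (^-+ u a b)) (≈-sym (assoc u _ _))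

    ^-*≈ε : ∀ u d → u ^ᵗ d ≈ ε → ∀ q → u ^ᵗ (q * d) ≈ ε
    ^-*≈ε u d p zero    = ≈-refl
    ^-*≈ε u d p (suc q) = begin
      u ^ᵗ (d + q * d)         ≈⟨ ^-+ u d (q * d) ⟩
      u ^ᵗ d ∙ u ^ᵗ (q * d)    ≈⟨ ∙-cong p (^-*≈ε u d p q) ⟩
      ε ∙ ε                    ≈⟨ identityˡ ε ⟩
      ε                        ∎

    ^-reduce : ∀ u d .{{_ : NonZero d}} → u ^ᵗ d ≈ ε → ∀ a → u ^ᵗ a ≈ u ^ᵗ (a % d)
    ^-reduce u d p a = begin
      u ^ᵗ a                                ≈⟨ ≡⇒≈ (cong (u ^ᵗ_) (m≡m%n+[m/n]*n a d)) ⟩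
      u ^ᵗ (a % d + a / d * d)              ≈⟨ ^-+ u (a % d) _ ⟩
      u ^ᵗ (a % d) ∙ u ^ᵗ (a / d * d)       ≈⟨ ∙-cong ≈-refl (^-*≈ε u d p (a / d)) ⟩
      u ^ᵗ (a % d) ∙ ε                      ≈⟨ identityʳ _ ⟩
      u ^ᵗ (a % d)                          ∎

    ^-∼ : ∀ u d .{{_ : NonZero d}} → u ^ᵗ d ≈ ε → ∀ {a b} → a ∼[ d ] b → u ^ᵗ a ≈ u ^ᵗ b
    ^-∼ u d p {a} {b} q = ≈-trans (^-reduce u d p a)
      (≈-trans (≡⇒≈ (cong (u ^ᵗ_) q)) (≈-sym (^-reduce u d p b)))

    yx≈xy^k : y ∙ x ≈ x ∙ y ^ᵗ k
    yx≈xy^k = begin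
      y ∙ x                ≈⟨ identityˡ _ ⟨
      ε ∙ (y ∙ x)          ≈⟨ ∙-cong (inverseʳ x) ≈-refl ⟨
      x ∙ x ⁻¹ ∙ (y ∙ x)   ≈⟨ assoc x _ _ ⟩
      x ∙ (x ⁻¹ ∙ (y ∙ x)) ≈⟨ ∙-cong ≈-refl (assoc _ y x) ⟨
      x ∙ (x ⁻¹ ∙ y ∙ x)   ≈⟨ ∙-cong ≈-refl (relator x⁻¹yx≈y^k) ⟩
      x ∙ y ^ᵗ k           ∎

    y^bx : ∀ b → y ^ᵗ b ∙ x ≈ x ∙ y ^ᵗ (b * k)
    y^bx zero    = ≈-trans (identityˡ x) (≈-sym (identityʳ x))
    y^bx (suc b) = begin
      y ∙ y ^ᵗ b ∙ x                 ≈⟨ assoc y _ x ⟩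
      y ∙ (y ^ᵗ b ∙ x)               ≈⟨ ∙-cong ≈-refl (y^bx b) ⟩
      y ∙ (x ∙ y ^ᵗ (b * k))         ≈⟨ assoc y x _ ⟨
      y ∙ x ∙ y ^ᵗ (b * k)           ≈⟨ ∙-cong yx≈xy^k ≈-refl ⟩
      x ∙ y ^ᵗ k ∙ y ^ᵗ (b * k)      ≈⟨ assoc x _ _ ⟩
      x ∙ (y ^ᵗ k ∙ y ^ᵗ (b * k))    ≈⟨ ∙-cong ≈-refl (^-+ y k (b * k)) ⟨
      x ∙ y ^ᵗ (k + b * k)           ∎

    y^bx^c : ∀ b c → y ^ᵗ b ∙ x ^ᵗ c ≈ x ^ᵗ c ∙ y ^ᵗ (b * k ^ c)
    y^bx^c b zero    = begin
      y ^ᵗ b ∙ ε         ≈⟨ identityʳ _ ⟩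
      y ^ᵗ b             ≈⟨ ≡⇒≈ (cong (y ^ᵗ_) (*-identityʳ b)) ⟨
      y ^ᵗ (b * 1)       ≈⟨ identityˡ _ ⟨
      ε ∙ y ^ᵗ (b * 1)   ∎
    y^bx^c b (suc c) = begin
      y ^ᵗ b ∙ (x ∙ x ^ᵗ c)              ≈⟨ assoc _ x _ ⟨
      y ^ᵗ b ∙ x ∙ x ^ᵗ c                ≈⟨ ∙-cong (y^bx b) ≈-refl ⟩
      x ∙ y ^ᵗ (b * k) ∙ x ^ᵗ c          ≈⟨ assoc x _ _ ⟩
      x ∙ (y ^ᵗ (b * k) ∙ x ^ᵗ c)        ≈⟨ ∙-cong ≈-refl (y^bx^c (b * k) c) ⟩
      x ∙ (x ^ᵗ c ∙ y ^ᵗ (b * k * k ^ c)) ≈⟨ assoc x _ _ ⟨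
      x ∙ x ^ᵗ c ∙ y ^ᵗ (b * k * k ^ c)  ≈⟨ ∙-cong ≈-refl (≡⇒≈ (cong (y ^ᵗ_) (*-assoc b k _))) ⟩
      x ∙ x ^ᵗ c ∙ y ^ᵗ (b * (k * k ^ c)) ∎

  x^y^ : ℕ × ℕ → Term Generator
  x^y^ (a , b) = x ^ᵗ a ∙ y ^ᵗ b

  x^y^-cong : ∀ {p q} → p ≋ q → x^y^ p ≈ x^y^ q
  x^y^-cong (p , q) = ∙-cong (^-∼ x m (relator x^m≈ε) p) (^-∼ y n (relator y^n≈ε) q)

  private
    x^y^-∙ : ∀ a b c d → x^y^ (a , b) ∙ x^y^ (c , d) ≈ x^y^ (a + c , b * k ^ c + d)
    x^y^-∙ a b c d = begin
      X a ∙ Y b ∙ (X c ∙ Y d)                ≈⟨ assoc (X a) _ _ ⟩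
      X a ∙ (Y b ∙ (X c ∙ Y d))              ≈⟨ ∙-cong ≈-refl (assoc (Y b) _ _) ⟨
      X a ∙ (Y b ∙ X c ∙ Y d)                ≈⟨ ∙-cong ≈-refl (∙-cong (y^bx^c b c) ≈-refl) ⟩
      X a ∙ (X c ∙ Y (b * k ^ c) ∙ Y d)      ≈⟨ ∙-cong ≈-refl (assoc (X c) _ _) ⟩
      X a ∙ (X c ∙ (Y (b * k ^ c) ∙ Y d))    ≈⟨ assoc (X a) _ _ ⟨
      X a ∙ X c ∙ (Y (b * k ^ c) ∙ Y d)
        ≈⟨ ∙-cong (^-+ x a c) (^-+ y (b * k ^ c) d) ⟨
      X (a + c) ∙ Y (b * k ^ c + d)          ∎
      where
      X Y : ℕ → Term Generator
      X = x ^ᵗ_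
      Y = y ^ᵗ_

    x^y^-exponents⁻¹ : ∀ u → u ≈ x^y^ (exponents u) → u ⁻¹ ≈ x^y^ (exponents (u ⁻¹))
    x^y^-exponents⁻¹ u p = ≈-sym (inverseˡ-unique _ u (begin
      x^y^ (exponents (u ⁻¹)) ∙ u                     ≈⟨ ∙-cong ≈-refl p ⟩
      x^y^ (exponents (u ⁻¹)) ∙ x^y^ (exponents u)    ≈⟨ x^y^-∙ (proj₁ (exponents (u ⁻¹))) _ _ _ ⟩
      x^y^ (exponents (u ⁻¹ ∙ u))                     ≈⟨ x^y^-cong (exponents-cong (inverseˡ u)) ⟩
      ε ∙ ε                                           ≈⟨ identityˡ ε ⟩
      ε                                               ∎))

  x^y^-exponents : ∀ u → u ≈ x^y^ (exponents u)
  x^y^-exponents (gen gx) = ≈-sym (≈-trans (identityʳ _) (identityʳ x))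
  x^y^-exponents (gen gy) = ≈-sym (≈-trans (identityˡ _) (identityʳ y))
  x^y^-exponents ε        = ≈-sym (identityˡ ε)
  x^y^-exponents (u ∙ v)  =
    ≈-trans (∙-cong (x^y^-exponents u) (x^y^-exponents v))
            (x^y^-∙ (proj₁ (exponents u)) _ _ _)
  x^y^-exponents (u ⁻¹)   = x^y^-exponents⁻¹ u (x^y^-exponents u)

  infix 4 _≈?_
  _≈?_ : Decidable _≈_
  u ≈? v = Dec.map′ to exponents-cong
    ((proj₁ (exponents u) % m ≟ proj₁ (exponents v) % m) ×-dec
     (proj₂ (exponents u) % n ≟ proj₂ (exponents v) % n))
    where
    to : exponents u ≋ exponents v → u ≈ v
    to p = ≈-trans (x^y^-exponents u) (≈-trans (x^y^-cong p) (≈-sym (x^y^-exponents v)))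

Matrix : ℕ → ℕ → Set
Matrix r c = Fin r → Fin c → ℕ

infix 4 _≐_
_≐_ : ∀ {r c} → Rel (Matrix r c) 0ℓ
M ≐ N = ∀ p q → M p q ≡ N p q

Θ : ∀ {r c} → Matrix r c
Θ _ _ = 0

Diag : ∀ m → List ℕ → Matrix m m
Diag m ps p q = if does ((p Fin.≟ q) ×-dec (toℕ p ∈? ps)) then 1 else 0

IsDiagonal : ∀ {m} → Matrix m m → Set
IsDiagonal M = ∀ p q → p ≢ q → M p q ≡ 0

nonzeroEntries : ∀ {r c} → Matrix r c → ℕ
nonzeroEntries {r} {c} M =
  length (filter (λ (p , q) → ¬? (M p q ≟ 0)) (cartesianProduct (allFin r) (allFin c)))

-- The (i , j) block; combine i p has value i * m + p.
block : ∀ {m n} → Matrix (n * m) (n * m) → Fin n → Fin n → Matrix m m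
block A i j p q = A (combine i p) (combine j q)

next : ∀ {n} .{{_ : NonZero n}} → Fin n → Fin n
next {n} i = suc (toℕ i) mod n

IsBlockCirculant : ∀ {m n} .{{_ : NonZero n}} → Matrix (n * m) (n * m) → Set
IsBlockCirculant {m} {n} A =
  ∀ i j → block {m} {n} A i j ≐ block {m} {n} A (next i) (next j)

adjacencyMatrix : ∀ {v} {E : Rel (Fin v) 0ℓ} → Decidable E → Matrix v v
adjacencyMatrix E? p q = if does (E? p q) then 1 else 0

CycleEdge : ∀ m .{{_ : NonZero m}} → Rel (Fin m) 0ℓ
CycleEdge m p q = q ≡ next p ⊎ p ≡ next q

cycleEdge? : ∀ m .{{_ : NonZero m}} → Decidable (CycleEdge m)
cycleEdge? m p q = (q Fin.≟ next p) ⊎-dec (p Fin.≟ next q)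

A[C_] : ∀ m .{{_ : NonZero m}} → Matrix m m
A[C m ] = adjacencyMatrix (cycleEdge? m)

CayleyEdge : (G : Group 0ℓ 0ℓ) → List (Group.Carrier G) → Rel (Group.Carrier G) 0ℓ
CayleyEdge G S u v = Any (λ s → v ≈ u · s) S
  where open Group G using (_≈_) renaming (_∙_ to _·_)

connectionSet : List (Term Generator)
connectionSet = x ∷ x ⁻¹ ∷ y ∷ y ⁻¹ ∷ []

𝒯Edge : (m n k : ℕ) → Rel (Term Generator) 0ℓ
𝒯Edge m n k = CayleyEdge (ℤ m ⋉[ k ]ℤ n) connectionSet

𝒯Edge? : ∀ m n k .{{_ : NonZero m}} .{{_ : NonZero n}} →
         ℤ.+ (k ^ m) ≡ 1ℤ [mod n ] → Decidable (𝒯Edge m n k)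
𝒯Edge? m n k k^m≡1 u v = any? (λ s → v ≈? u ∙ s) connectionSet
  where open WordProblem m n k k^m≡1

-- The vertex of the packet Vᵢ at position p = τ α + ξ.
packetVertex : ∀ {m n} (k α : ℕ) .{{_ : NonZero α}} → Fin n → Fin m → Term Generator
packetVertex k α i p = x ^ᵗ (τ * α + ξ) ∙ y ^ᵗ (toℕ i * k ^ ξ)
  where
  τ = toℕ p / α
  ξ = toℕ p % α

packetOrdering : ∀ m n (k α : ℕ) .{{_ : NonZero α}} → Fin (n * m) → Term Generator
packetOrdering m n k α v = uncurry (packetVertex {m} {n} k α) (remQuot m v)

A[𝒯] : ∀ m n k α .{{_ : NonZero m}} .{{_ : NonZero n}} .{{_ : NonZero α}} →
       ℤ.+ (k ^ m) ≡ 1ℤ [mod n ] → Matrix (n * m) (n * m)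
A[𝒯] m n k α k^m≡1 = adjacencyMatrix λ u v →
  𝒯Edge? m n k k^m≡1 (packetOrdering m n k α u) (packetOrdering m n k α v)

{-# OPTIONS --safe #-}

-- Since α divides m, the factor k^ξ in the packet vertex x^p y^(i k^ξ) may be replaced by
-- k^p.  Comparing exponents, (i , p) and (j , q) are then adjacent iff either i = j and
-- p, q are neighbours on the cycle, or p = q and (j − i) k^p ≡ ±1 (mod n).  This depends on
-- i and j only through j − i, so A is block-circulant.  Let β be the least positive exponent
-- with k^β ≡ ±1.  For ξ < β and j − i ≡ ±k^(α−ξ), the second condition says p ≡ ξ (mod β);
-- conversely it forces j − i ≡ ±k^(α−ξ) with ξ = p mod β.  Finally β is α or α / 2.
module Submission where

open import Data.Bool.Base using (if_then_else_)
open import Data.Fin.Base as Fin using (Fin; toℕ; fromℕ<; combine)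
import Data.Fin.Properties as Fin
open import Data.Integer.Base as ℤ using (ℤ; +_; -[1+_]; 0ℤ; 1ℤ; -1ℤ)
import Data.Integer.Divisibility.Signed as ℤ
import Data.Integer.Properties as ℤ
open import Data.Integer.Tactic.RingSolver using (solve-∀)
open import Data.List.Base using (List; map; upTo; tabulate; filter; length; allFin; cartesianProduct)
open import Data.List.Membership.Propositional using () renaming (_∈_ to _∈ᴸ_)
open import Data.List.Membership.Propositional.Properties
open import Data.List.Membership.Propositional.Properties.WithK using (unique∧set⇒bag)
open import Data.List.Properties using (length-tabulate; filter-≐)
open import Data.List.Relation.Binary.BagAndSetEquality using (∼bag⇒↭)
open import Data.List.Relation.Binary.Permutation.Propositional.Properties using (↭-length)
open import Data.List.Relation.Unary.Any using (here; there)
open import Data.List.Relation.Unary.Unique.Propositional.Properties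
  using (filter⁺; cartesianProduct⁺; allFin⁺; tabulate⁺)
open import Data.Nat.Base
  using (ℕ; NonZero; zero; suc; pred; _≤_; _<_; _+_; _*_; _∸_; _^_; _/_; _%_; z≤n; s≤s; >-nonZero)
open import Data.Nat.Coprimality using (Coprime)
open import Data.Nat.Divisibility as ℕ using (_∣_; divides)
open import Data.Nat.DivMod
open import Data.Nat.Induction using (<-rec)
open import Data.Nat.Properties
open import Data.List.Membership.DecPropositional _≟_ using (_∈_; _∈?_)
open import Data.Product using (_×_; _,_; proj₁; proj₂; uncurry; ∃-syntax)
open import Data.Sum.Base as Sum using (_⊎_; inj₁; inj₂)
open import Function.Base using (_∘_; id; case_of_)
open import Function.Bundles using (_⇔_; mk⇔; Equivalence)
open import Function.Construct.Composition using (_⇔-∘_)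
open import Function.Construct.Symmetry using (⇔-sym)
open import Level using (0ℓ)
open import Relation.Binary.Bundles using (Setoid)
open import Relation.Binary.Core using (Rel)
open import Relation.Binary.PropositionalEquality
  using (_≡_; _≢_; refl; sym; trans; cong; cong₂; subst; subst₂)
import Relation.Binary.Reasoning.Setoid as SetoidReasoning
open import Relation.Binary.Structures using (IsEquivalence)
open import Relation.Nullary using (¬_; Dec; yes; no; contradiction; _×-dec_; _⊎-dec_; ¬?)
open import Relation.Nullary.Decidable using (does; does-⇔; map′)
open import Relation.Unary using (Pred; Decidable)
open import Defs

-- Congruence of integers modulo `d`.

infix 4 _≈[_]_

-- A record rather than a synonym for `_≡_[mod_]`, which unfolds to divisibility of an absolute
-- value, from which `a` and `b` cannot be inferred. The explicit quotient reduces each closure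
-- property to a ring identity.
record _≈[_]_ (a : ℤ) (d : ℕ) (b : ℤ) : Set where
  constructor congruent
  field
    quotient : ℤ
    equality : a ≡ b ℤ.+ quotient ℤ.* + d

module _ {d : ℕ} where

  ≈-refl : ∀ {a} → a ≈[ d ] a
  ≈-refl {a} = congruent 0ℤ (sym (ℤ.+-identityʳ a))

  ≈-reflexive : ∀ {a b} → a ≡ b → a ≈[ d ] b
  ≈-reflexive refl = ≈-refl

  ≈-sym : ∀ {a b} → a ≈[ d ] b → b ≈[ d ] a
  ≈-sym {b = b} (congruent q eq) = congruent (ℤ.- q)
    (trans (lemma b q (+ d)) (cong (λ c → c ℤ.+ (ℤ.- q) ℤ.* + d) (sym eq)))
    where
    lemma : ∀ b q d → b ≡ (b ℤ.+ q ℤ.* d) ℤ.+ (ℤ.- q) ℤ.* d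
    lemma = solve-∀

  ≈-trans : ∀ {a b c} → a ≈[ d ] b → b ≈[ d ] c → a ≈[ d ] c
  ≈-trans {c = c} (congruent p refl) (congruent q refl) =
    congruent (q ℤ.+ p) (lemma c p q (+ d))
    where
    lemma : ∀ c p q d → (c ℤ.+ q ℤ.* d) ℤ.+ p ℤ.* d ≡ c ℤ.+ (q ℤ.+ p) ℤ.* d
    lemma = solve-∀

  +-≈ : ∀ {a a′ b b′} → a ≈[ d ] a′ → b ≈[ d ] b′ → a ℤ.+ b ≈[ d ] a′ ℤ.+ b′
  +-≈ {a′ = a} {b′ = b} (congruent p refl) (congruent q refl) =
    congruent (p ℤ.+ q) (lemma a b p q (+ d))
    where
    lemma : ∀ a b p q d → (a ℤ.+ p ℤ.* d) ℤ.+ (b ℤ.+ q ℤ.* d) ≡ (a ℤ.+ b) ℤ.+ (p ℤ.+ q) ℤ.* d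
    lemma = solve-∀

  *-≈ : ∀ {a a′ b b′} → a ≈[ d ] a′ → b ≈[ d ] b′ → a ℤ.* b ≈[ d ] a′ ℤ.* b′
  *-≈ {a′ = a} {b′ = b} (congruent p refl) (congruent q refl) =
    congruent (a ℤ.* q ℤ.+ p ℤ.* b ℤ.+ p ℤ.* q ℤ.* + d) (lemma a b p q (+ d))
    where
    lemma : ∀ a b p q d → (a ℤ.+ p ℤ.* d) ℤ.* (b ℤ.+ q ℤ.* d) ≡
            a ℤ.* b ℤ.+ (a ℤ.* q ℤ.+ p ℤ.* b ℤ.+ p ℤ.* q ℤ.* d) ℤ.* d
    lemma = solve-∀

  neg-≈ : ∀ {a b} → a ≈[ d ] b → ℤ.- a ≈[ d ] ℤ.- b
  neg-≈ {b = b} (congruent q refl) = congruent (ℤ.- q) (lemma b q (+ d))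
    where
    lemma : ∀ b q d → ℤ.- (b ℤ.+ q ℤ.* d) ≡ (ℤ.- b) ℤ.+ (ℤ.- q) ℤ.* d
    lemma = solve-∀

  ≈-isEquivalence : IsEquivalence (_≈[ d ]_)
  ≈-isEquivalence = record { refl = ≈-refl ; sym = ≈-sym ; trans = ≈-trans }

  ≡mod⇒≈ : ∀ {a b} → a ≡ b [mod d ] → a ≈[ d ] b
  ≡mod⇒≈ {a} {b} d∣a-b with ℤ.divides q eq ← ℤ.∣ᵤ⇒∣ {+ d} {a ℤ.- b} d∣a-b =
    congruent q (trans (lemma a b) (cong (λ c → b ℤ.+ c) eq))
    where
    lemma : ∀ a b → a ≡ b ℤ.+ (a ℤ.- b)
    lemma = solve-∀

  ≈⇒≡mod : ∀ {a b} → a ≈[ d ] b → a ≡ b [mod d ]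
  ≈⇒≡mod {b = b} (congruent q refl) = ℤ.∣⇒∣ᵤ (ℤ.divides q (lemma b (q ℤ.* + d)))
    where
    lemma : ∀ b c → (b ℤ.+ c) ℤ.- b ≡ c
    lemma = solve-∀

  -≈0⇒≈ : ∀ {a b} → a ℤ.- b ≈[ d ] 0ℤ → a ≈[ d ] b
  -≈0⇒≈ {a} {b} a-b≈0 = ≈-trans (≈-reflexive (lemma a b))
    (≈-trans (+-≈ a-b≈0 (≈-refl {a = b})) (≈-reflexive (ℤ.+-identityˡ b)))
    where
    lemma : ∀ a b → a ≡ (a ℤ.- b) ℤ.+ b
    lemma = solve-∀

  module _ .{{_ : NonZero d}} where

    %-≈ : ∀ a → + (a % d) ≈[ d ] + a
    %-≈ a = ≈-sym (congruent (+ (a / d)) (trans (cong +_ (m≡m%n+[m/n]*n a d))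
      (trans (ℤ.pos-+ (a % d) _) (cong (λ c → + (a % d) ℤ.+ c) (ℤ.pos-* (a / d) d)))))

    %≡⇒≈ : ∀ {a b} → a % d ≡ b % d → + a ≈[ d ] + b
    %≡⇒≈ {a} {b} eq = ≈-trans (≈-sym (%-≈ a)) (≈-trans (≈-reflexive (cong +_ eq)) (%-≈ b))

    private
      %-+* : ∀ {a b} q → + a ≡ + b ℤ.+ + q ℤ.* + d → a % d ≡ b % d
      %-+* {a} {b} q eq = trans (cong (_% d) (ℤ.+-injective (trans eq
        (trans (cong (λ c → + b ℤ.+ c) (sym (ℤ.pos-* q d))) (sym (ℤ.pos-+ b (q * d)))))))
        ([m+kn]%n≡m%n b q d)

    ≈⇒%≡ : ∀ {a b} → + a ≈[ d ] + b → a % d ≡ b % d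
    ≈⇒%≡ (congruent (+ q) eq) = %-+* q eq
    -- A negative quotient turns positive when the two sides are swapped.
    ≈⇒%≡ p@(congruent -[1+ q ] _) = sym (%-+* (suc q) (_≈[_]_.equality (≈-sym p)))

    <∧≈⇒≡ : ∀ {a b} → a < d → b < d → + a ≈[ d ] + b → a ≡ b
    <∧≈⇒≡ a<d b<d a≈b = trans (sym (m<n⇒m%n≡m a<d)) (trans (≈⇒%≡ a≈b) (m<n⇒m%n≡m b<d))

    toℕ-≈-injective : ∀ {i j : Fin d} → + toℕ i ≈[ d ] + toℕ j → i ≡ j
    toℕ-≈-injective {i} {j} = Fin.toℕ-injective ∘ <∧≈⇒≡ (Fin.toℕ<n i) (Fin.toℕ<n j)

    toℕ-next : ∀ (i : Fin d) → + toℕ (next i) ≈[ d ] + toℕ i ℤ.+ 1ℤ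
    toℕ-next i = ≈-trans (≈-reflexive (cong +_ (Fin.toℕ-fromℕ< _))) (≈-trans (%-≈ (suc (toℕ i)))
      (≈-reflexive (trans (cong +_ (+-comm 1 (toℕ i))) (ℤ.pos-+ (toℕ i) 1))))

    -- The exponents of an inverse are natural numbers with factors `pred m` and `pred n`, which
    -- serve as -1.
    pred-≈ : + pred d ≈[ d ] -1ℤ
    pred-≈ = congruent 1ℤ (trans (lemma (+ pred d))
      (cong (λ c → -1ℤ ℤ.+ 1ℤ ℤ.* c) (trans (sym (ℤ.pos-+ 1 (pred d))) (cong +_ (suc-pred d)))))
      where
      lemma : ∀ a → a ≡ -1ℤ ℤ.+ 1ℤ ℤ.* (1ℤ ℤ.+ a)
      lemma = solve-∀

≈-setoid : ℕ → Setoid 0ℓ 0ℓ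
≈-setoid d = record { isEquivalence = ≈-isEquivalence {d} }

-- Congruence up to sign.

infix 4 _≈±[_]_

_≈±[_]_ : ℤ → ℕ → ℤ → Set
a ≈±[ d ] b = a ≈[ d ] b ⊎ a ≈[ d ] ℤ.- b

module _ {d : ℕ} where

  ≈±-isEquivalence : IsEquivalence (_≈±[ d ]_)
  ≈±-isEquivalence = record
    { refl  = inj₁ ≈-refl
    ; sym   = ±-sym
    ; trans = ±-trans
    }
    where
    -‿flip : ∀ {a b} → a ≈[ d ] ℤ.- b → ℤ.- a ≈[ d ] b
    -‿flip {b = b} p = ≈-trans (neg-≈ p) (≈-reflexive (ℤ.neg-involutive b))

    ±-sym : ∀ {a b} → a ≈±[ d ] b → b ≈±[ d ] a
    ±-sym (inj₁ p) = inj₁ (≈-sym p)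
    ±-sym (inj₂ p) = inj₂ (≈-sym (-‿flip p))

    ±-trans : ∀ {a b c} → a ≈±[ d ] b → b ≈±[ d ] c → a ≈±[ d ] c
    ±-trans (inj₁ p) (inj₁ q) = inj₁ (≈-trans p q)
    ±-trans (inj₁ p) (inj₂ q) = inj₂ (≈-trans p q)
    ±-trans (inj₂ p) (inj₁ q) = inj₂ (≈-trans p (neg-≈ q))
    ±-trans (inj₂ p) (inj₂ q) = inj₁ (≈-trans p (-‿flip q))

  *-≈± : ∀ {a a′ b b′} → a ≈±[ d ] a′ → b ≈±[ d ] b′ → a ℤ.* b ≈±[ d ] a′ ℤ.* b′
  *-≈± (inj₁ p) (inj₁ q) = inj₁ (*-≈ p q)
  *-≈± {a′ = a} {b′ = b} (inj₁ p) (inj₂ q) =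
    inj₂ (≈-trans (*-≈ p q) (≈-reflexive (sym (ℤ.neg-distribʳ-* a b))))
  *-≈± {a′ = a} {b′ = b} (inj₂ p) (inj₁ q) =
    inj₂ (≈-trans (*-≈ p q) (≈-reflexive (sym (ℤ.neg-distribˡ-* a b))))
  *-≈± {a′ = a} {b′ = b} (inj₂ p) (inj₂ q) =
    inj₁ (≈-trans (*-≈ p q) (≈-reflexive (lemma a b)))
    where
    lemma : ∀ a b → (ℤ.- a) ℤ.* (ℤ.- b) ≡ a ℤ.* b
    lemma = solve-∀

≈±-setoid : ℕ → Setoid 0ℓ 0ℓ
≈±-setoid d = record { isEquivalence = ≈±-isEquivalence {d} }

-- Powers of `k` and its order for a multiplicative equivalence.

record IsOrder (R : Rel ℤ 0ℓ) (k β : ℕ) : Set where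

  private
    infix 4 _~_
    _~_ : Rel ℤ 0ℓ
    _~_ = R

  field
    positive : 0 < β
    k^β~1    : + (k ^ β) ~ 1ℤ
    minimal  : ∀ d → 0 < d → + (k ^ d) ~ 1ℤ → β ≤ d

pos-^-+ : ∀ k a b → + (k ^ (a + b)) ≡ + (k ^ a) ℤ.* + (k ^ b)
pos-^-+ k a b = trans (cong +_ (^-distribˡ-+-* k a b)) (ℤ.pos-* (k ^ a) (k ^ b))

-- Applied both to congruence modulo n and to congruence modulo n up to sign.
module Powers {R : Rel ℤ 0ℓ} (isEquivalence : IsEquivalence R)
              (*-cong : ∀ {a a′ b b′} → R a a′ → R b b′ → R (a ℤ.* b) (a′ ℤ.* b′))
              (k : ℕ) where

  private
    setoid : Setoid 0ℓ 0ℓ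
    setoid = record { isEquivalence = isEquivalence }
    infix 4 _~_
    _~_ : Rel ℤ 0ℓ
    _~_ = R
    module ~ = IsEquivalence isEquivalence

  open SetoidReasoning setoid

  k^[q*e]~1 : ∀ {e} → + (k ^ e) ~ 1ℤ → ∀ q → + (k ^ (q * e)) ~ 1ℤ
  k^[q*e]~1 k^e~1 zero = ~.refl
  k^[q*e]~1 {e} k^e~1 (suc q) = begin
    + (k ^ (e + q * e))            ≡⟨ pos-^-+ k e (q * e) ⟩
    + (k ^ e) ℤ.* + (k ^ (q * e))  ≈⟨ *-cong k^e~1 (k^[q*e]~1 k^e~1 q) ⟩
    1ℤ ∎

  k^a~k^[a%e] : ∀ {e} .{{_ : NonZero e}} → + (k ^ e) ~ 1ℤ → ∀ a → + (k ^ a) ~ + (k ^ (a % e))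
  k^a~k^[a%e] {e} k^e~1 a = begin
    + (k ^ a)                                   ≡⟨ cong (λ c → + (k ^ c)) (m≡m%n+[m/n]*n a e) ⟩
    + (k ^ (a % e + a / e * e))                 ≡⟨ pos-^-+ k (a % e) _ ⟩
    + (k ^ (a % e)) ℤ.* + (k ^ (a / e * e))
      ≈⟨ *-cong (~.refl {+ (k ^ (a % e))}) (k^[q*e]~1 {e} k^e~1 (a / e)) ⟩
    + (k ^ (a % e)) ℤ.* 1ℤ                      ≡⟨ ℤ.*-identityʳ _ ⟩
    + (k ^ (a % e))                             ∎

  k^-% : ∀ {e} .{{_ : NonZero e}} → + (k ^ e) ~ 1ℤ →
         ∀ {a b} → a % e ≡ b % e → + (k ^ a) ~ + (k ^ b)
  k^-% k^e~1 {a} {b} eq = begin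
    + (k ^ a)          ≈⟨ k^a~k^[a%e] k^e~1 a ⟩
    + (k ^ (a % _))    ≡⟨ cong (λ c → + (k ^ c)) eq ⟩
    + (k ^ (b % _))    ≈⟨ k^a~k^[a%e] k^e~1 b ⟨
    + (k ^ b)          ∎

  -- The remainder of `a` modulo `β` is again an exponent giving 1, and it is smaller than `β`, so
  -- minimality leaves only 0.
  order∣ : ∀ {β} → IsOrder R k β → ∀ {a} → + (k ^ a) ~ 1ℤ → β ∣ a
  order∣ {β} record { positive = 0<β ; k^β~1 = k^β~1 ; minimal = minimal } {a} k^a~1 =
    ℕ.m%n≡0⇒n∣m a β (n≮0⇒n≡0 λ 0<a%β → <⇒≱ (m%n<n a β) (minimal (a % β) 0<a%β
      (~.trans (~.sym (k^a~k^[a%e] k^β~1 a)) k^a~1)))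
    where
    instance
      β≢0 : NonZero β
      β≢0 = >-nonZero 0<β
    n≮0⇒n≡0 : ∀ {n} → ¬ 0 < n → n ≡ 0
    n≮0⇒n≡0 {n} = n≤0⇒n≡0 ∘ ≮⇒≥

  -- The hypothesis makes `k ^ b` an inverse of `k ^ a`; dividing by a unit becomes multiplying by
  -- another power of `k`.
  cancel-k^ : ∀ {a b} → + (k ^ a) ℤ.* + (k ^ b) ~ 1ℤ →
              ∀ {u v} → u ℤ.* + (k ^ a) ~ v → u ~ v ℤ.* + (k ^ b)
  cancel-k^ {a} {b} k^a*k^b~1 {u} {v} u*k^a~v = begin
    u                                  ≡⟨ ℤ.*-identityʳ u ⟨
    u ℤ.* 1ℤ                           ≈⟨ *-cong (~.refl {u}) k^a*k^b~1 ⟨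
    u ℤ.* (+ (k ^ a) ℤ.* + (k ^ b))    ≡⟨ ℤ.*-assoc u _ _ ⟨
    u ℤ.* + (k ^ a) ℤ.* + (k ^ b)      ≈⟨ *-cong u*k^a~v (~.refl {+ (k ^ b)}) ⟩
    v ℤ.* + (k ^ b)                    ∎

-- Arithmetic progressions and counts of nonzero entries.

∈-arithmetic⇔ : ∀ {m ξ β T} .{{_ : NonZero β}} → ξ < β → m ≡ T * β → ∀ {a} → a < m →
                a ∈ map (λ c → ξ + c * β) (upTo T) ⇔ a % β ≡ ξ
∈-arithmetic⇔ {m} {ξ} {β} {T} ξ<β m≡T*β {a} a<m = mk⇔ to from
  where
  to : a ∈ map (λ c → ξ + c * β) (upTo T) → a % β ≡ ξ
  to a∈ with c , _ , refl ← ∈-map⁻ _ a∈ = trans ([m+kn]%n≡m%n ξ c β) (m<n⇒m%n≡m ξ<β)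

  from : a % β ≡ ξ → a ∈ map (λ c → ξ + c * β) (upTo T)
  -- The index in the progression is the quotient `a / β`, and `a < T * β` puts it below `T`.
  from a%β≡ξ = subst (_∈ _) (sym (trans (m≡m%n+[m/n]*n a β) (cong (_+ a / β * β) a%β≡ξ)))
    (∈-map⁺ _ (∈-upTo⁺ (m<n*o⇒m/o<n (subst (a <_) m≡T*β a<m))))

indicator≢0⇔ : ∀ {P : Set} (P? : Dec P) → (if does P? then 1 else 0) ≢ 0 ⇔ P
indicator≢0⇔ (yes p) = mk⇔ (λ _ → p) (λ _ ())
indicator≢0⇔ (no ¬p) = mk⇔ (λ 0≢0 → contradiction refl 0≢0) (λ p → contradiction p ¬p)

-- The filtered list of pairs and `tabulate f` are both free of duplicates and have the same
-- members, so they are permutations of each other and have equal length.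
nonzeroEntries≡ : ∀ {r c N} (M : Matrix r c) (f : Fin N → Fin r × Fin c) →
                  (∀ {s t} → f s ≡ f t → s ≡ t) →
                  (∀ p q → M p q ≢ 0 ⇔ (∃[ t ] (p , q) ≡ f t)) →
                  nonzeroEntries M ≡ N
nonzeroEntries≡ {r} {c} {N} M f f-injective support =
  trans (↭-length (∼bag⇒↭ (unique∧set⇒bag
          (filter⁺ nonzero? (cartesianProduct⁺ (allFin⁺ r) (allFin⁺ c)))
          (tabulate⁺ f-injective) (λ {pq} → mk⇔ (to pq) (from pq)))))
        (length-tabulate f)
  where
  nonzero? : Decidable (λ ((p , q) : Fin r × Fin c) → M p q ≢ 0)
  nonzero? (p , q) = ¬? (M p q ≟ 0)

  pairs : List (Fin r × Fin c)
  pairs = cartesianProduct (allFin r) (allFin c)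

  to : ∀ pq → pq ∈ᴸ filter nonzero? pairs → pq ∈ᴸ tabulate f
  to (p , q) pq∈
    with t , refl ← Equivalence.to (support p q) (proj₂ (∈-filter⁻ nonzero? {xs = pairs} pq∈)) =
    ∈-tabulate⁺ t

  from : ∀ pq → pq ∈ᴸ tabulate f → pq ∈ᴸ filter nonzero? pairs
  from (p , q) pq∈ =
    ∈-filter⁺ nonzero? (∈-cartesianProduct⁺ (∈-allFin p) (∈-allFin q))
      (Equivalence.from (support p q) (∈-tabulate⁻ pq∈))

-- Descent: a smaller witness restarts the search, and when the bounded search finds none, `a`
-- itself is least.
least : ∀ {P : Pred ℕ 0ℓ} → Decidable P → ∀ a → P a → ∃[ b ] (P b × (∀ d → P d → b ≤ d))
least {P} P? = <-rec _ λ a rec Pa → case anyUpTo? P? a of λ where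
  (yes (b , b<a , Pb)) → rec b<a Pb
  (no ∄)               → a , Pa , λ d Pd → ≮⇒≥ λ d<a → ∄ (d , d<a , Pd)

nonzeroEntries-cong : ∀ {r c} {M N : Matrix r c} → M ≐ N → nonzeroEntries M ≡ nonzeroEntries N
nonzeroEntries-cong {r} {c} M≐N = cong length (filter-≐ _ _
  ((λ {(p , q)} M≢0 → M≢0 ∘ trans (M≐N p q)) ,
   (λ {(p , q)} N≢0 → N≢0 ∘ trans (sym (M≐N p q))))
  (cartesianProduct (allFin r) (allFin c)))

nonzeroEntries-Θ : ∀ {r c} → nonzeroEntries (Θ {r} {c}) ≡ 0
nonzeroEntries-Θ {r} {c} = nonzeroEntries≡ (Θ {r} {c}) (λ ()) (λ { {()} }) λ p q →
  mk⇔ (λ 0≢0 → contradiction refl 0≢0) λ ()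

-- The support is enumerated by `Fin T` through the positions `ξ + t * β`; since `ξ < β`, even the
-- last of them stays below `T * β`.
nonzeroEntries-Diag : ∀ {m ξ β} T → ξ < β → m ≡ T * β →
                      nonzeroEntries (Diag m (map (λ c → ξ + c * β) (upTo T))) ≡ T
nonzeroEntries-Diag {m} {ξ} {β} T ξ<β m≡T*β =
  nonzeroEntries≡ (Diag m ps) (λ t → f t , f t) f-injective λ p q →
  mk⇔ (to p q) (from p q) ⇔-∘ indicator≢0⇔ ((p Fin.≟ q) ×-dec (toℕ p ∈? ps))
  where
  ps : List ℕ
  ps = map (λ c → ξ + c * β) (upTo T)

  instance
    β≢0 : NonZero β
    β≢0 = >-nonZero (≤-trans (s≤s z≤n) ξ<β)

  bound : ∀ (t : Fin T) → ξ + toℕ t * β < m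
  bound t = subst (ξ + toℕ t * β <_) (sym m≡T*β)
    (<-≤-trans (+-monoˡ-< (toℕ t * β) ξ<β) (*-monoˡ-≤ β (Fin.toℕ<n t)))

  f : Fin T → Fin m
  f t = fromℕ< (bound t)

  toℕ-f : ∀ t → toℕ (f t) ≡ ξ + toℕ t * β
  toℕ-f t = Fin.toℕ-fromℕ< (bound t)

  f-injective : ∀ {s t} → (f s , f s) ≡ (f t , f t) → s ≡ t
  f-injective {s} {t} eq = Fin.toℕ-injective (*-cancelʳ-≡ _ _ β (+-cancelˡ-≡ ξ _ _
    (trans (sym (toℕ-f s)) (trans (cong (toℕ ∘ proj₁) eq) (toℕ-f t)))))

  to : ∀ p q → p ≡ q × toℕ p ∈ ps → ∃[ t ] (p , q) ≡ (f t , f t)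
  to p _ (refl , p∈) with c , c∈ , p≡ ← ∈-map⁻ _ p∈ = t , cong₂ _,_ p≡ft p≡ft
    where
    t = fromℕ< (∈-upTo⁻ c∈)
    p≡ft : p ≡ f t
    p≡ft = Fin.toℕ-injective (trans p≡ (sym (trans (toℕ-f t)
             (cong (λ c → ξ + c * β) (Fin.toℕ-fromℕ< (∈-upTo⁻ c∈))))))

  from : ∀ p q → (∃[ t ] (p , q) ≡ (f t , f t)) → p ≡ q × toℕ p ∈ ps
  from p q (t , refl) = refl , subst (_∈ ps) (sym (toℕ-f t)) (∈-map⁺ _ (∈-upTo⁺ (Fin.toℕ<n t)))

-- Packet vertices and their edges in coordinates.

exponents-x^ : ∀ m n k .{{_ : NonZero m}} .{{_ : NonZero n}} (k^m≡1 : + (k ^ m) ≡ 1ℤ [mod n ]) →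
               ∀ a → WordProblem.exponents m n k k^m≡1 (x ^ᵗ a) ≡ (a , 0)
exponents-x^ m n k k^m≡1 zero    = refl
exponents-x^ m n k k^m≡1 (suc a) rewrite exponents-x^ m n k k^m≡1 a = refl

exponents-y^ : ∀ m n k .{{_ : NonZero m}} .{{_ : NonZero n}} (k^m≡1 : + (k ^ m) ≡ 1ℤ [mod n ]) →
               ∀ b → WordProblem.exponents m n k k^m≡1 (y ^ᵗ b) ≡ (0 , b)
exponents-y^ m n k k^m≡1 zero    = refl
exponents-y^ m n k k^m≡1 (suc b) rewrite exponents-y^ m n k k^m≡1 b = refl

module PacketBlocks (m n k α : ℕ) .{{_ : NonZero m}} .{{_ : NonZero n}} .{{_ : NonZero α}}
                    (k^m≡1 : + (k ^ m) ≡ 1ℤ [mod n ]) (order : IsMultiplicativeOrder n k α) where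

  open WordProblem m n k k^m≡1
  open Presentation (Relator m n k) using ()
    renaming (_≈_ to _≈ᴳ_; ≈-trans to ≈ᴳ-trans; ≈-sym to ≈ᴳ-sym)
  module P  = Powers (≈-isEquivalence {n}) *-≈ k
  module P± = Powers (≈±-isEquivalence {n}) *-≈± k

  k^m≈1 : + (k ^ m) ≈[ n ] 1ℤ
  k^m≈1 = ≡mod⇒≈ k^m≡1

  k^α≈1 : + (k ^ α) ≈[ n ] 1ℤ
  k^α≈1 = ≡mod⇒≈ (IsMultiplicativeOrder.k^α≡1 order)

  α-isOrder : IsOrder (_≈[ n ]_) k α
  α-isOrder = record
    { positive = positive
    ; k^β~1    = k^α≈1
    ; minimal  = λ d 0<d → minimal d 0<d ∘ ≈⇒≡mod
    }
    where open IsMultiplicativeOrder order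

  α∣m : α ∣ m
  α∣m = P.order∣ α-isOrder k^m≈1

  V : Fin n → Fin m → Term Generator
  V = packetVertex k α

  -- A packet vertex writes its position as quotient and remainder by `α`; the exponent of `x`
  -- reassembles `p`, while that of `y` keeps the remainder.
  exponents-V : ∀ i p → exponents (V i p) ≡ (toℕ p , toℕ i * k ^ (toℕ p % α))
  exponents-V i p
    rewrite exponents-x^ m n k k^m≡1 (toℕ p / α * α + toℕ p % α)
          | exponents-y^ m n k k^m≡1 (toℕ i * k ^ (toℕ p % α)) =
    cong (_, toℕ i * k ^ (toℕ p % α))
      (trans (+-identityʳ _) (trans (+-comm _ (toℕ p % α)) (sym (m≡m%n+[m/n]*n (toℕ p) α))))

  -- Each term equals its normal form, and the two normal forms agree. Together with
  -- `exponents-cong` this turns edges into congruences.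
  exponents-injective : ∀ {u v} → exponents u ≋ exponents v → u ≈ᴳ v
  exponents-injective {u} {v} p =
    ≈ᴳ-trans (x^y^-exponents u) (≈ᴳ-trans (x^y^-cong p) (≈ᴳ-sym (x^y^-exponents v)))

  _⊝_ : Fin n → Fin n → ℤ
  j ⊝ i = + toℕ j ℤ.- + toℕ i

  -- The powers of k on both sides are rewritten as k^q, so that i and j enter
  -- the condition only through j − i.
  y-exponent⇔ : ∀ i j p q c e → q % m ≡ (p + c) % m →
                (j * k ^ (q % α)) % n ≡ (i * k ^ (p % α) * k ^ c + e) % n
                ⇔ (+ j ℤ.- + i) ℤ.* + (k ^ q) ≈[ n ] + e
  y-exponent⇔ i j p q c e q≡p+c = mk⇔ to from
    where
    open SetoidReasoning (≈-setoid n)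
    Q = + (k ^ q)

    lhs : + (j * k ^ (q % α)) ≈[ n ] + j ℤ.* Q
    lhs = begin
      + (j * k ^ (q % α))         ≡⟨ ℤ.pos-* j _ ⟩
      + j ℤ.* + (k ^ (q % α))     ≈⟨ *-≈ (≈-refl {a = + j}) (P.k^a~k^[a%e] {α} k^α≈1 q) ⟨
      + j ℤ.* Q                   ∎

    rhs : + (i * k ^ (p % α) * k ^ c + e) ≈[ n ] + i ℤ.* Q ℤ.+ + e
    rhs = begin
      + (i * k ^ (p % α) * k ^ c + e)
        ≡⟨ ℤ.pos-+ _ e ⟩
      + (i * k ^ (p % α) * k ^ c) ℤ.+ + e
        ≡⟨ cong (λ z → z ℤ.+ + e) (trans (cong +_ (*-assoc i _ _)) (trans (ℤ.pos-* i _)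
             (cong (λ z → + i ℤ.* z) (ℤ.pos-* (k ^ (p % α)) _)))) ⟩
      + i ℤ.* (+ (k ^ (p % α)) ℤ.* + (k ^ c)) ℤ.+ + e
        ≈⟨ +-≈ (*-≈ (≈-refl {a = + i}) (*-≈ (P.k^a~k^[a%e] {α} k^α≈1 p) (≈-refl {a = + (k ^ c)})))
              (≈-refl {a = + e}) ⟨
      + i ℤ.* (+ (k ^ p) ℤ.* + (k ^ c)) ℤ.+ + e
        ≡⟨ cong (λ z → + i ℤ.* z ℤ.+ + e) (pos-^-+ k p c) ⟨
      + i ℤ.* + (k ^ (p + c)) ℤ.+ + e
        ≈⟨ +-≈ (*-≈ (≈-refl {a = + i}) (P.k^-% {m} k^m≈1 {q} {p + c} q≡p+c)) (≈-refl {a = + e}) ⟨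
      + i ℤ.* Q ℤ.+ + e ∎

    to : (j * k ^ (q % α)) % n ≡ (i * k ^ (p % α) * k ^ c + e) % n → (+ j ℤ.- + i) ℤ.* Q ≈[ n ] + e
    to eq = begin
      (+ j ℤ.- + i) ℤ.* Q                           ≡⟨ lemma (+ j) (+ i) Q ⟩
      + j ℤ.* Q ℤ.+ ℤ.- (+ i ℤ.* Q)
        ≈⟨ +-≈ (≈-trans (≈-sym lhs) (≈-trans (%≡⇒≈ eq) rhs))
               (≈-refl {a = ℤ.- (+ i ℤ.* Q)}) ⟩
      + i ℤ.* Q ℤ.+ + e ℤ.+ ℤ.- (+ i ℤ.* Q)         ≡⟨ lemma′ (+ i ℤ.* Q) (+ e) ⟩
      + e                                           ∎
      where
      lemma : ∀ j i Q → (j ℤ.- i) ℤ.* Q ≡ j ℤ.* Q ℤ.+ ℤ.- (i ℤ.* Q)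
      lemma = solve-∀
      lemma′ : ∀ a e → a ℤ.+ e ℤ.+ ℤ.- a ≡ e
      lemma′ = solve-∀

    from : (+ j ℤ.- + i) ℤ.* Q ≈[ n ] + e → (j * k ^ (q % α)) % n ≡ (i * k ^ (p % α) * k ^ c + e) % n
    from eq = ≈⇒%≡ (begin
      + (j * k ^ (q % α))                       ≈⟨ lhs ⟩
      + j ℤ.* Q                                 ≡⟨ lemma (+ j) (+ i) Q ⟩
      + i ℤ.* Q ℤ.+ (+ j ℤ.- + i) ℤ.* Q         ≈⟨ +-≈ (≈-refl {a = + i ℤ.* Q}) eq ⟩
      + i ℤ.* Q ℤ.+ + e                         ≈⟨ rhs ⟨
      + (i * k ^ (p % α) * k ^ c + e)           ∎)
      where
      lemma : ∀ j i Q → j ℤ.* Q ≡ i ℤ.* Q ℤ.+ (j ℤ.- i) ℤ.* Q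
      lemma = solve-∀

  -- The integers `γ` and `η` stand in for the exponents of `s`, so that an inverse generator can be
  -- treated as a step by -1.
  V-step⇔ : ∀ i j p q s {γ η} → + proj₁ (exponents s) ≈[ m ] γ → + proj₂ (exponents s) ≈[ n ] η →
            V j q ≈ᴳ V i p ∙ s
            ⇔ (+ toℕ q ≈[ m ] + toℕ p ℤ.+ γ × (j ⊝ i) ℤ.* + (k ^ toℕ q) ≈[ n ] η)
  V-step⇔ i j p q s {γ} {η} c≈γ e≈η = mk⇔ to from
    where
    c = proj₁ (exponents s)
    e = proj₂ (exponents s)
    b⇔ = y-exponent⇔ (toℕ i) (toℕ j) (toℕ p) (toℕ q) c e
    p+c≈ : + (toℕ p + c) ≈[ m ] + toℕ p ℤ.+ γ
    p+c≈ = ≈-trans (≈-reflexive (ℤ.pos-+ (toℕ p) c)) (+-≈ (≈-refl {a = + toℕ p}) c≈γ)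

    -- An equality of types, so that one `subst id` replaces both vertices by their exponents.
    exponents≡ : (exponents (V j q) ≋ exponents (V i p ∙ s)) ≡
                 ((toℕ q , toℕ j * k ^ (toℕ q % α)) ≋
                  (toℕ p + c , toℕ i * k ^ (toℕ p % α) * k ^ c + e))
    exponents≡ = cong₂ (λ v u → v ≋ (proj₁ u + c , proj₂ u * k ^ c + e))
                       (exponents-V j q) (exponents-V i p)

    to : V j q ≈ᴳ V i p ∙ s → + toℕ q ≈[ m ] + toℕ p ℤ.+ γ × (j ⊝ i) ℤ.* + (k ^ toℕ q) ≈[ n ] η
    to v≈us with a≡ , b≡ ← subst id exponents≡ (exponents-cong {V j q} {V i p ∙ s} v≈us) =
      ≈-trans (%≡⇒≈ a≡) p+c≈ , ≈-trans (Equivalence.to (b⇔ a≡) b≡) e≈η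

    from : + toℕ q ≈[ m ] + toℕ p ℤ.+ γ × (j ⊝ i) ℤ.* + (k ^ toℕ q) ≈[ n ] η → V j q ≈ᴳ V i p ∙ s
    from (a≈ , b≈) = exponents-injective {V j q} {V i p ∙ s}
      (subst id (sym exponents≡) (a≡ , Equivalence.from (b⇔ a≡) (≈-trans b≈ (≈-sym e≈η))))
      where
      a≡ : toℕ q % m ≡ (toℕ p + c) % m
      a≡ = ≈⇒%≡ (≈-trans a≈ (≈-sym p+c≈))

  -- The left summand collects the edges along `x`, the right one those along `y`. Only the class of
  -- `δ` modulo `n` matters, by `Adjacent-cong`.
  Adjacent : ℤ → Rel (Fin m) 0ℓ
  Adjacent δ p q = (δ ≈[ n ] 0ℤ × CycleEdge m p q) ⊎ (p ≡ q × δ ℤ.* + (k ^ toℕ p) ≈±[ n ] 1ℤ)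

  Adjacent-cong : ∀ {δ δ′} → δ ≈[ n ] δ′ → ∀ {p q} → Adjacent δ p q → Adjacent δ′ p q
  Adjacent-cong δ≈δ′ (inj₁ (δ≈0 , e)) = inj₁ (≈-trans (≈-sym δ≈δ′) δ≈0 , e)
  Adjacent-cong δ≈δ′ {p} (inj₂ (p≡q , u)) =
    inj₂ (p≡q , ±.trans (inj₁ (*-≈ (≈-sym δ≈δ′) (≈-refl {a = + (k ^ toℕ p)}))) u)
    where module ± = IsEquivalence (≈±-isEquivalence {n})

  -- The exponents `a` and `pred m * a` add up to `m * a`, and `k ^ m` is 1 modulo `n`.
  k^-inverse : ∀ a → + (k ^ a) ℤ.* + (k ^ (pred m * a)) ≈[ n ] 1ℤ
  k^-inverse a = ≈-trans (≈-reflexive (trans (sym (pos-^-+ k a _))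
                   (cong (λ c → + (k ^ c)) (trans (cong (_* a) (suc-pred m)) (*-comm m a)))))
                   (P.k^[q*e]~1 k^m≈1 a)

  -- For an edge along `x` the condition on the exponents of `y` has right side 0; as powers of `k`
  -- are units, `δ` itself vanishes modulo `n`.
  *k^≈0⇒≈0 : ∀ {δ} a → δ ℤ.* + (k ^ a) ≈[ n ] 0ℤ → δ ≈[ n ] 0ℤ
  *k^≈0⇒≈0 {δ} a p = P.cancel-k^ {a} {pred m * a} (k^-inverse a) {δ} {0ℤ} p

  next⇒≈ : ∀ {p q : Fin m} → q ≡ next p → + toℕ q ≈[ m ] + toℕ p ℤ.+ 1ℤ
  next⇒≈ {p} refl = toℕ-next p

  ≈⇒next : ∀ {p q : Fin m} → + toℕ q ≈[ m ] + toℕ p ℤ.+ 1ℤ → q ≡ next p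
  ≈⇒next {p} q≈p+1 = toℕ-≈-injective (≈-trans q≈p+1 (≈-sym (toℕ-next p)))

  -- `x` and `x ⁻¹` yield the two directions of a cycle edge inside one packet; `y` and `y ⁻¹` keep
  -- the position and yield the two signs.
  edge⇔ : ∀ i j p q → 𝒯Edge m n k (V i p) (V j q) ⇔ Adjacent (j ⊝ i) p q
  edge⇔ i j p q = mk⇔ to from
    where
    δ : ℤ
    δ = j ⊝ i

    step : ∀ s {γ η} → + proj₁ (exponents s) ≈[ m ] γ → + proj₂ (exponents s) ≈[ n ] η →
           V j q ≈ᴳ V i p ∙ s ⇔ (+ toℕ q ≈[ m ] + toℕ p ℤ.+ γ × δ ℤ.* + (k ^ toℕ q) ≈[ n ] η)
    step = V-step⇔ i j p q

    x-step = step x {1ℤ} {0ℤ} ≈-refl ≈-refl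
    x⁻¹-step = step (x ⁻¹) { -1ℤ } {0ℤ}
      (≈-trans (≈-reflexive (cong +_ (*-identityʳ (pred m)))) pred-≈)
      (≈-reflexive (cong (λ c → + (c * k ^ (pred m * 1))) (*-zeroʳ (pred n))))
    y-step = step y {0ℤ} {1ℤ} ≈-refl ≈-refl
    y⁻¹-step = step (y ⁻¹) {0ℤ} { -1ℤ }
      (≈-reflexive (cong +_ (*-zeroʳ (pred m))))
      (≈-trans (≈-reflexive (cong +_ (trans (cong (λ c → pred n * 1 * k ^ c) (*-zeroʳ (pred m)))
        (trans (*-identityʳ _) (*-identityʳ _))))) pred-≈)

    move : ∀ {a b} c → a ≈[ m ] b ℤ.- c → b ≈[ m ] a ℤ.+ c
    move {b = b} c p = ≈-trans (≈-reflexive (lemma b c)) (+-≈ (≈-sym p) (≈-refl {a = c}))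
      where
      lemma : ∀ b c → b ≡ (b ℤ.- c) ℤ.+ c
      lemma = solve-∀
    move′ : ∀ {a b} c → b ≈[ m ] a ℤ.+ c → a ≈[ m ] b ℤ.- c
    move′ {a = a} c p = ≈-trans (≈-reflexive (lemma a c)) (+-≈ (≈-sym p) (≈-refl {a = ℤ.- c}))
      where
      lemma : ∀ a c → a ≡ (a ℤ.+ c) ℤ.- c
      lemma = solve-∀

    stay : + toℕ q ≈[ m ] + toℕ p ℤ.+ 0ℤ → p ≡ q
    stay q≈p = sym (toℕ-≈-injective (≈-trans q≈p (≈-reflexive (ℤ.+-identityʳ _))))

    vertical : ∀ {η} → (η ≡ 1ℤ ⊎ η ≡ -1ℤ) →
               + toℕ q ≈[ m ] + toℕ p ℤ.+ 0ℤ × δ ℤ.* + (k ^ toℕ q) ≈[ n ] η → Adjacent δ p q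
    vertical η≡±1 (q≈ , u) with refl ← stay q≈ =
      inj₂ (refl , Sum.map (≈-trans u ∘ ≈-reflexive) (≈-trans u ∘ ≈-reflexive) η≡±1)

    to : 𝒯Edge m n k (V i p) (V j q) → Adjacent δ p q
    to (here v≈) = let q≈ , z = Equivalence.to x-step v≈ in
      inj₁ (*k^≈0⇒≈0 (toℕ q) z , inj₁ (≈⇒next q≈))
    -- A step by -1 from `p` to `q` is the successor relation read from `q` to `p`.
    to (there (here v≈)) = let q≈ , z = Equivalence.to x⁻¹-step v≈ in
      inj₁ (*k^≈0⇒≈0 (toℕ q) z , inj₂ (≈⇒next (move 1ℤ q≈)))
    to (there (there (here v≈))) = vertical (inj₁ refl) (Equivalence.to y-step v≈)
    to (there (there (there (here v≈)))) = vertical (inj₂ refl) (Equivalence.to y⁻¹-step v≈)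

    q≈p+0 : p ≡ q → + toℕ q ≈[ m ] + toℕ p ℤ.+ 0ℤ
    q≈p+0 refl = ≈-reflexive (sym (ℤ.+-identityʳ _))

    from : Adjacent δ p q → 𝒯Edge m n k (V i p) (V j q)
    from (inj₁ (z , inj₁ q≡)) =
      here (Equivalence.from x-step (next⇒≈ q≡ , *-≈ z (≈-refl {a = + (k ^ toℕ q)})))
    from (inj₁ (z , inj₂ p≡)) =
      there (here (Equivalence.from x⁻¹-step
        (move′ 1ℤ (next⇒≈ p≡) , *-≈ z (≈-refl {a = + (k ^ toℕ q)}))))
    from (inj₂ (refl , inj₁ u)) =
      there (there (here (Equivalence.from y-step (q≈p+0 refl , u))))
    from (inj₂ (refl , inj₂ u)) =
      there (there (there (here (Equivalence.from y⁻¹-step (q≈p+0 refl , u)))))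

  -- Blocks of the adjacency matrix.

  A : Matrix (n * m) (n * m)
  A = A[𝒯] m n k α k^m≡1

  A⟨_,_⟩ : Fin n → Fin n → Matrix m m
  A⟨_,_⟩ = block {m} {n} A

  packetOrdering-combine : ∀ i p → packetOrdering m n k α (combine i p) ≡ V i p
  packetOrdering-combine i p = cong (uncurry V) (Fin.remQuot-combine i p)

  -- `does` depends only on the truth of what is decided, so an entry may be computed with any
  -- decision of an equivalent proposition, in particular with those that define `A[C_]` and `Diag`.
  block≡ : ∀ i j p q {P : Set} (P? : Dec P) → Adjacent (j ⊝ i) p q ⇔ P →
           A⟨ i , j ⟩ p q ≡ (if does P? then 1 else 0)
  block≡ i j p q P? adj⇔P =
    trans (cong₂ (λ u v → if does (𝒯Edge? m n k k^m≡1 u v) then 1 else 0)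
                 (packetOrdering-combine i p) (packetOrdering-combine j q))
          (cong (if_then 1 else 0) (does-⇔ (adj⇔P ⇔-∘ edge⇔ i j p q)
            (𝒯Edge? m n k k^m≡1 (V i p) (V j q)) P?))

  block≡0 : ∀ i j p q → ¬ Adjacent (j ⊝ i) p q → A⟨ i , j ⟩ p q ≡ 0
  -- The decision chosen is `no`, whose indicator evaluates to 0.
  block≡0 i j p q ¬adj = block≡ i j p q (no ¬adj) (mk⇔ id id)

  ⊝-next : ∀ i j → next j ⊝ next i ≈[ n ] j ⊝ i
  ⊝-next i j = ≈-trans (+-≈ (toℕ-next j) (neg-≈ (toℕ-next i)))
    (≈-reflexive (lemma (+ toℕ j) (+ toℕ i)))
    where
    lemma : ∀ j i → (j ℤ.+ 1ℤ) ℤ.- (i ℤ.+ 1ℤ) ≡ j ℤ.- i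
    lemma = solve-∀

  -- Shifting both indices preserves `j ⊝ i` modulo `n`, wrap-around included. Both entries are
  -- evaluated with the single decision `edge?`.
  blockCirculant : IsBlockCirculant {m} {n} A
  blockCirculant i j p q =
    trans (block≡ i j p q edge?
             (mk⇔ (Equivalence.from (edge⇔ (next i) (next j) p q) ∘ Adjacent-cong (≈-sym (⊝-next i j)))
                  (Adjacent-cong (⊝-next i j) ∘ Equivalence.to (edge⇔ (next i) (next j) p q))))
          (sym (block≡ (next i) (next j) p q edge? (⇔-sym (edge⇔ (next i) (next j) p q))))
    where edge? = 𝒯Edge? m n k k^m≡1 (V (next i) p) (V (next j) q)

  ⊝≈0⇒≡ : ∀ {i j} → j ⊝ i ≈[ n ] 0ℤ → j ≡ i
  ⊝≈0⇒≡ = toℕ-≈-injective ∘ -≈0⇒≈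

  offDiagonal-adjacent : ∀ {i j} → j ≢ i → ∀ {p q} → Adjacent (j ⊝ i) p q →
                         p ≡ q × (j ⊝ i) ℤ.* + (k ^ toℕ p) ≈±[ n ] 1ℤ
  offDiagonal-adjacent j≢i (inj₁ (z , _)) = contradiction (⊝≈0⇒≡ z) j≢i
  offDiagonal-adjacent j≢i (inj₂ adj)     = adj

  offDiagonal-isDiagonal : ∀ {i j} → j ≢ i → IsDiagonal A⟨ i , j ⟩
  offDiagonal-isDiagonal {i} {j} j≢i p q p≢q =
    block≡0 i j p q (p≢q ∘ proj₁ ∘ offDiagonal-adjacent j≢i)

  -- Within one packet `δ` is 0, so an edge along `y` would need 0 to be ±1 modulo `n`, which
  -- `2 ≤ n` excludes.
  diagonal≐ : 2 ≤ n → ∀ i → A⟨ i , i ⟩ ≐ A[C m ]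
  diagonal≐ 2≤n i p q = block≡ i i p q (cycleEdge? m p q) (mk⇔ to from)
    where
    δ≈0 : i ⊝ i ≈[ n ] 0ℤ
    δ≈0 = ≈-reflexive (ℤ.+-inverseʳ (+ toℕ i))

    0≉1 : ¬ 0ℤ ≈[ n ] 1ℤ
    0≉1 p = contradiction (<∧≈⇒≡ (≤-trans (s≤s z≤n) 2≤n) 2≤n p) λ ()

    to : Adjacent (i ⊝ i) p q → CycleEdge m p q
    to adj with Adjacent-cong δ≈0 adj
    ... | inj₁ (_ , e)        = e
    ... | inj₂ (_ , inj₁ u) = contradiction u 0≉1
    ... | inj₂ (_ , inj₂ u) = contradiction (neg-≈ u) 0≉1

    from : CycleEdge m p q → Adjacent (i ⊝ i) p q
    from e = inj₁ (δ≈0 , e)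

  -- Off-diagonal blocks and the order of `k` up to sign.

  Offset : Fin n → Fin n → ℕ → Set
  Offset i j ξ = + toℕ j ≡ + toℕ i ± + (k ^ (α ∸ ξ)) [mod n ]

  offset? : ∀ i j ξ → Dec (Offset i j ξ)
  offset? i j ξ = (n ℕ.∣? _) ⊎-dec (n ℕ.∣? _)

  offset⇔ : ∀ i j ξ → Offset i j ξ ⇔ (j ⊝ i ≈±[ n ] + (k ^ (α ∸ ξ)))
  offset⇔ i j ξ = mk⇔ (Sum.map (to K) (to (ℤ.- K))) (Sum.map (from K) (from (ℤ.- K)))
    where
    K = + (k ^ (α ∸ ξ))

    to : ∀ c → + toℕ j ≡ + toℕ i ℤ.+ c [mod n ] → j ⊝ i ≈[ n ] c
    to c p = ≈-trans
      (+-≈ (≡mod⇒≈ {a = + toℕ j} {b = + toℕ i ℤ.+ c} p) (≈-refl {a = ℤ.- + toℕ i}))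
      (≈-reflexive (lemma (+ toℕ i) c))
      where
      lemma : ∀ i c → i ℤ.+ c ℤ.- i ≡ c
      lemma = solve-∀

    from : ∀ c → j ⊝ i ≈[ n ] c → + toℕ j ≡ + toℕ i ℤ.+ c [mod n ]
    from c p = ≈⇒≡mod (≈-trans (≈-reflexive (lemma (+ toℕ j) (+ toℕ i)))
      (+-≈ (≈-refl {a = + toℕ i}) p))
      where
      lemma : ∀ j i → j ≡ i ℤ.+ (j ℤ.- i)
      lemma = solve-∀

  -- With β the order of k in ℤₙˣ / {±1}, both cases of the theorem take the same form:
  -- β = α in case (i) and β = α / 2 in case (ii).
  module SignedOrder {β : ℕ} (T : ℕ) .{{_ : NonZero β}}
                     (β-isOrder : IsOrder (_≈±[ n ]_) k β) (m≡T*β : m ≡ T * β) where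

    open SetoidReasoning (≈±-setoid n)

    module ≈± = IsEquivalence (≈±-isEquivalence {n})

    k^β≈±1 : + (k ^ β) ≈±[ n ] 1ℤ
    k^β≈±1 = IsOrder.k^β~1 β-isOrder

    β∣α : β ∣ α
    β∣α = P±.order∣ β-isOrder (inj₁ k^α≈1)

    β≤α : β ≤ α
    β≤α = ℕ.∣⇒≤ β∣α

    -- As `ξ < β ≤ α`, the subtraction `α ∸ ξ` is not truncated, and the exponents add up to `α`.
    k^ξ*k^[α∸ξ] : ∀ {ξ} → ξ < β → + (k ^ ξ) ℤ.* + (k ^ (α ∸ ξ)) ≈±[ n ] 1ℤ
    k^ξ*k^[α∸ξ] {ξ} ξ<β = begin
      + (k ^ ξ) ℤ.* + (k ^ (α ∸ ξ))   ≡⟨ pos-^-+ k ξ (α ∸ ξ) ⟨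
      + (k ^ (ξ + (α ∸ ξ)))           ≡⟨ cong (λ a → + (k ^ a)) (m+[n∸m]≡n (≤-trans (<⇒≤ ξ<β) β≤α)) ⟩
      + (k ^ α)                       ≈⟨ inj₁ k^α≈1 ⟩
      1ℤ                              ∎

    -- Up to sign only `a % β` matters, so `k ^ (α ∸ a % β)` is an inverse of `k ^ a`. This names
    -- the `ξ` that a nonzero entry at position `a` calls for.
    unit⇒offset : ∀ {δ} a → δ ℤ.* + (k ^ a) ≈±[ n ] 1ℤ → δ ≈±[ n ] + (k ^ (α ∸ a % β))
    unit⇒offset {δ} a u = begin
      δ                               ≈⟨ P±.cancel-k^ {a} {α ∸ a % β} inverse {δ} {1ℤ} u ⟩
      1ℤ ℤ.* + (k ^ (α ∸ a % β))      ≡⟨ ℤ.*-identityˡ _ ⟩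
      + (k ^ (α ∸ a % β))             ∎
      where
      inverse : + (k ^ a) ℤ.* + (k ^ (α ∸ a % β)) ≈±[ n ] 1ℤ
      inverse = ≈±.trans
        (*-≈± (P±.k^a~k^[a%e] {β} k^β≈±1 a) (≈±.refl {+ (k ^ (α ∸ a % β))}))
        (k^ξ*k^[α∸ξ] (m%n<n a β))

    -- The product is `k ^ (a + (α ∸ ξ))` up to sign, hence ±1 exactly when `β` divides that
    -- exponent. Because `β` divides `α`, this means that `a` and `ξ` agree modulo `β`.
    offset⇒unit⇔ : ∀ {δ ξ} → ξ < β → δ ≈±[ n ] + (k ^ (α ∸ ξ)) → ∀ a →
                   δ ℤ.* + (k ^ a) ≈±[ n ] 1ℤ ⇔ a % β ≡ ξ
    offset⇒unit⇔ {δ} {ξ} ξ<β δ≈ a = mk⇔ to from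
      where
      δk^a≈ : δ ℤ.* + (k ^ a) ≈±[ n ] + (k ^ a) ℤ.* + (k ^ (α ∸ ξ))
      δk^a≈ = begin
        δ ℤ.* + (k ^ a)                    ≈⟨ *-≈± δ≈ (≈±.refl {+ (k ^ a)}) ⟩
        + (k ^ (α ∸ ξ)) ℤ.* + (k ^ a)      ≡⟨ ℤ.*-comm (+ (k ^ (α ∸ ξ))) _ ⟩
        + (k ^ a) ℤ.* + (k ^ (α ∸ ξ))      ∎

      to : δ ℤ.* + (k ^ a) ≈±[ n ] 1ℤ → a % β ≡ ξ
      -- Adding `α`, a multiple of `β`, leaves the remainder of `a` unchanged; regrouped as
      -- `a + (α ∸ ξ) + ξ`, the sum loses its first two terms modulo `β`.
      to u = trans (sym (%-remove-+ʳ a β∣α))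
        (trans (cong (_% β) (trans
          (cong (λ b → a + b) (sym (m∸n+n≡m (≤-trans (<⇒≤ ξ<β) β≤α)))) (sym (+-assoc a _ ξ))))
        (trans (%-remove-+ˡ ξ β∣a+α∸ξ) (m<n⇒m%n≡m ξ<β)))
        where
        β∣a+α∸ξ : β ∣ a + (α ∸ ξ)
        β∣a+α∸ξ = P±.order∣ β-isOrder (begin
          + (k ^ (a + (α ∸ ξ)))            ≡⟨ pos-^-+ k a (α ∸ ξ) ⟩
          + (k ^ a) ℤ.* + (k ^ (α ∸ ξ))    ≈⟨ δk^a≈ ⟨
          δ ℤ.* + (k ^ a)                  ≈⟨ u ⟩
          1ℤ                               ∎)

      from : a % β ≡ ξ → δ ℤ.* + (k ^ a) ≈±[ n ] 1ℤ
      from refl = begin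
        δ ℤ.* + (k ^ a)                        ≈⟨ δk^a≈ ⟩
        + (k ^ a) ℤ.* + (k ^ (α ∸ ξ))
          ≈⟨ *-≈± (P±.k^a~k^[a%e] {β} k^β≈±1 a) (≈±.refl {+ (k ^ (α ∸ ξ))}) ⟩
        + (k ^ ξ) ℤ.* + (k ^ (α ∸ ξ))          ≈⟨ k^ξ*k^[α∸ξ] ξ<β ⟩
        1ℤ                                     ∎

    offset⇒Diag : ∀ {i j} → j ≢ i → ∀ ξ → ξ < β → Offset i j ξ →
                  A⟨ i , j ⟩ ≐ Diag m (map (λ c → ξ + c * β) (upTo T))
    offset⇒Diag {i} {j} j≢i ξ ξ<β offset p q =
      block≡ i j p q ((p Fin.≟ q) ×-dec (toℕ p ∈? map (λ c → ξ + c * β) (upTo T))) (mk⇔ to from)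
      where
      unit⇔ : (j ⊝ i) ℤ.* + (k ^ toℕ p) ≈±[ n ] 1ℤ ⇔ toℕ p % β ≡ ξ
      unit⇔ = offset⇒unit⇔ ξ<β (Equivalence.to (offset⇔ i j ξ) offset) (toℕ p)

      ∈⇔ : toℕ p ∈ map (λ c → ξ + c * β) (upTo T) ⇔ toℕ p % β ≡ ξ
      ∈⇔ = ∈-arithmetic⇔ ξ<β m≡T*β (Fin.toℕ<n p)

      to : Adjacent (j ⊝ i) p q → p ≡ q × toℕ p ∈ map (λ c → ξ + c * β) (upTo T)
      to adj = let p≡q , u = offDiagonal-adjacent j≢i adj in
        p≡q , Equivalence.from ∈⇔ (Equivalence.to unit⇔ u)

      from : p ≡ q × toℕ p ∈ map (λ c → ξ + c * β) (upTo T) → Adjacent (j ⊝ i) p q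
      from (p≡q , p∈) = inj₂ (p≡q , Equivalence.from unit⇔ (Equivalence.to ∈⇔ p∈))

    -- A single nonzero entry, at position `p`, would already provide the offset `toℕ p % β`.
    noOffset⇒Θ : ∀ {i j} → j ≢ i → ¬ (∃[ ξ ] (ξ < β × Offset i j ξ)) → A⟨ i , j ⟩ ≐ Θ
    noOffset⇒Θ {i} {j} j≢i ∄ p q = block≡0 i j p q λ adj →
      ∄ (toℕ p % β , m%n<n (toℕ p) β , Equivalence.from (offset⇔ i j (toℕ p % β))
          (unit⇒offset {j ⊝ i} (toℕ p) (proj₂ (offDiagonal-adjacent j≢i adj))))

    nonzeroEntries-offDiagonal : ∀ {i j} → j ≢ i →
      nonzeroEntries A⟨ i , j ⟩ ≡ 0 ⊎ nonzeroEntries A⟨ i , j ⟩ ≡ T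
    nonzeroEntries-offDiagonal {i} {j} j≢i with anyUpTo? (offset? i j) β
    ... | yes (ξ , ξ<β , offset) = inj₂ (trans (nonzeroEntries-cong (offset⇒Diag j≢i ξ ξ<β offset))
                                               (nonzeroEntries-Diag T ξ<β m≡T*β))
    ... | no ∄ = inj₁ (trans (nonzeroEntries-cong (noOffset⇒Θ j≢i ∄)) (nonzeroEntries-Θ {m} {m}))

  -- The order of `k` up to sign in the two cases, and the entry counts.

  m≡[m/α]*α : m ≡ m / α * α
  m≡[m/α]*α = sym (m/n*n≡m α∣m)

  -- When -1 is not a power of `k`, allowing a sign adds no new exponents.
  isSignedOrder-α : (∀ s → ¬ (+ (k ^ s) ≡ -1ℤ [mod n ])) → IsOrder (_≈±[ n ]_) k α
  isSignedOrder-α -1∉⟨k⟩ = record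
    { positive = IsOrder.positive α-isOrder
    ; k^β~1    = inj₁ k^α≈1
    ; minimal  = λ where
        d 0<d (inj₁ p) → IsOrder.minimal α-isOrder d 0<d p
        d 0<d (inj₂ p) → contradiction (≈⇒≡mod p) (-1∉⟨k⟩ d)
    }

  -- Squaring removes the sign, so an order up to sign is at least half of `α`.
  k^[d+d]≈1 : ∀ d → + (k ^ d) ≈±[ n ] 1ℤ → + (k ^ (d + d)) ≈[ n ] 1ℤ
  k^[d+d]≈1 d (inj₁ p) = ≈-trans (≈-reflexive (pos-^-+ k d d)) (*-≈ p p)
  k^[d+d]≈1 d (inj₂ p) = ≈-trans (≈-reflexive (pos-^-+ k d d)) (*-≈ p p)

  α≤d+d : ∀ d → 0 < d → + (k ^ d) ≈±[ n ] 1ℤ → α ≤ d + d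
  α≤d+d d 0<d u = IsOrder.minimal α-isOrder (d + d) (≤-trans 0<d (m≤m+n d d)) (k^[d+d]≈1 d u)

  module _ (2∣α : 2 ∣ α) where

    α≡2*[α/2] : α ≡ 2 * (α / 2)
    α≡2*[α/2] = sym (trans (*-comm 2 (α / 2)) (m/n*n≡m 2∣α))

    -- Minimality is `α≤d+d` halved, which is where the evenness of `α` enters.
    isSignedOrder-α/2 : + (k ^ (α / 2)) ≡ -1ℤ [mod n ] → IsOrder (_≈±[ n ]_) k (α / 2)
    isSignedOrder-α/2 k^[α/2]≡-1 = record
      { positive = n≢0⇒n>0 λ α/2≡0 →
          contradiction (trans α≡2*[α/2] (cong (2 *_) α/2≡0)) (m<n⇒n≢0 (IsOrder.positive α-isOrder))
      ; k^β~1    = inj₂ (≡mod⇒≈ k^[α/2]≡-1)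
      ; minimal  = λ d 0<d u → *-cancelˡ-≤ 2 (subst₂ _≤_ α≡2*[α/2]
          (cong (λ e → d + e) (sym (+-identityʳ d))) (α≤d+d d 0<d u))
      }

    m≡2*[m/α]*[α/2] : m ≡ 2 * (m / α) * (α / 2)
    m≡2*[m/α]*[α/2] = trans m≡[m/α]*α (trans (cong (m / α *_) α≡2*[α/2])
      (trans (sym (*-assoc (m / α) 2 (α / 2))) (cong (_* (α / 2)) (*-comm (m / α) 2))))

  ≈±1? : ∀ d → Dec (+ (k ^ d) ≈±[ n ] 1ℤ)
  ≈±1? d = map′ (Sum.map ≡mod⇒≈ ≡mod⇒≈) (Sum.map ≈⇒≡mod ≈⇒≡mod) ((n ℕ.∣? _) ⊎-dec (n ℕ.∣? _))

  -- A search below `α` produces the order up to sign without deciding beforehand whether -1 is a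
  -- power of `k`; the entry count is asserted outside the two cases.
  signedOrder : ∃[ β ] IsOrder (_≈±[ n ]_) k β
  signedOrder with least (λ d → (0 <? d) ×-dec ≈±1? d) α (IsOrder.positive α-isOrder , inj₁ k^α≈1)
  ... | β , (0<β , k^β≈±1) , minimal = β , record
    { positive = 0<β ; k^β~1 = k^β≈±1 ; minimal = λ d 0<d u → minimal d (0<d , u) }

  -- The order `β` up to sign divides `α`, and `α ≤ 2 * β`, so `α` is `β` or `2 * β`; accordingly
  -- `m / β` is `t` or `2 * t`.
  nonzeroEntries-trichotomy : ∀ {i j} → j ≢ i →
    nonzeroEntries A⟨ i , j ⟩ ≡ 0
    ⊎ nonzeroEntries A⟨ i , j ⟩ ≡ m / α
    ⊎ nonzeroEntries A⟨ i , j ⟩ ≡ 2 * (m / α)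
  nonzeroEntries-trichotomy {i} {j} j≢i with β , β-isOrder ← signedOrder =
    cases (P±.order∣ β-isOrder (inj₁ k^α≈1))
    where
    0<β = IsOrder.positive β-isOrder
    instance
      β≢0 : NonZero β
      β≢0 = >-nonZero 0<β

    α≤2*β : α ≤ 2 * β
    α≤2*β = subst (α ≤_) (cong (λ e → β + e) (sym (+-identityʳ β)))
      (α≤d+d β 0<β (IsOrder.k^β~1 β-isOrder))

    entries : ∀ T → m ≡ T * β → nonzeroEntries A⟨ i , j ⟩ ≡ 0 ⊎ nonzeroEntries A⟨ i , j ⟩ ≡ T
    entries T m≡T*β = SignedOrder.nonzeroEntries-offDiagonal T β-isOrder m≡T*β j≢i

    cases : β ∣ α → _
    cases (divides 0 α≡0) = contradiction α≡0 (m<n⇒n≢0 (IsOrder.positive α-isOrder))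
    cases (divides 1 α≡β) =
      Sum.map₂ inj₁ (entries (m / α) (trans m≡[m/α]*α (cong (m / α *_) (trans α≡β (*-identityˡ β)))))
    cases (divides 2 α≡2β) =
      Sum.map₂ inj₂ (entries (2 * (m / α)) (trans m≡[m/α]*α (trans (cong (m / α *_) α≡2β)
        (trans (sym (*-assoc (m / α) 2 β)) (cong (_* β) (*-comm (m / α) 2))))))
    -- A quotient of at least 3 contradicts `α ≤ 2 * β`, as `β` is positive.
    cases (divides (suc (suc (suc c))) α≡) =
      contradiction (*-cancelʳ-≤ (3 + c) 2 β (subst (_≤ 2 * β) α≡ α≤2*β)) λ { (s≤s (s≤s ())) }

theorem1 :
  (m n k α : ℕ) .{{_ : NonZero m}} .{{_ : NonZero n}} .{{_ : NonZero α}} →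
  3 ≤ m → 3 ≤ n → Coprime k n →
  (k^m≡1 : + (k ^ m) ≡ 1ℤ [mod n ]) →
  IsMultiplicativeOrder n k α →
  let t = m / α
      A = A[𝒯] m n k α k^m≡1
      A⟨_,_⟩ = block {m} {n} A
      Offset = λ (i j : Fin n) (ξ : ℕ) → + toℕ j ≡ + toℕ i ± + (k ^ (α ∸ ξ)) [mod n ]
  in
  IsBlockCirculant {m} {n} A
  × (∀ i → A⟨ i , i ⟩ ≐ A[C m ])
  × (∀ i j → j ≢ i →
       IsDiagonal A⟨ i , j ⟩
       × (nonzeroEntries A⟨ i , j ⟩ ≡ 0
          ⊎ nonzeroEntries A⟨ i , j ⟩ ≡ t
          ⊎ nonzeroEntries A⟨ i , j ⟩ ≡ 2 * t))
  × ((∀ s → ¬ (+ (k ^ s) ≡ -1ℤ [mod n ])) →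
       ∀ i j → j ≢ i →
       (∀ ξ → ξ < α → Offset i j ξ →
          A⟨ i , j ⟩ ≐ Diag m (map (λ c → ξ + c * α) (upTo t)))
       × (¬ (∃[ ξ ] (ξ < α × Offset i j ξ)) → A⟨ i , j ⟩ ≐ Θ))
  × (2 ∣ α → + (k ^ (α / 2)) ≡ -1ℤ [mod n ] →
       ∀ i j → j ≢ i →
       (∀ ξ → ξ < α / 2 → Offset i j ξ →
          A⟨ i , j ⟩ ≐ Diag m (map (λ c → ξ + c * (α / 2)) (upTo (2 * t))))
       × (¬ (∃[ ξ ] (ξ < α / 2 × Offset i j ξ)) → A⟨ i , j ⟩ ≐ Θ))
theorem1 m n k α _ 3≤n _ k^m≡1 order =
  blockCirculant ,
  diagonal≐ (<⇒≤ 3≤n) ,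
  (λ i j j≢i → offDiagonal-isDiagonal j≢i , nonzeroEntries-trichotomy j≢i) ,
  (λ -1∉⟨k⟩ i j j≢i →
     let β-isOrder = isSignedOrder-α -1∉⟨k⟩ in
     SignedOrder.offset⇒Diag (m / α) β-isOrder m≡[m/α]*α j≢i ,
     SignedOrder.noOffset⇒Θ (m / α) β-isOrder m≡[m/α]*α j≢i) ,
  (λ 2∣α k^[α/2]≡-1 i j j≢i →
     let β-isOrder = isSignedOrder-α/2 2∣α k^[α/2]≡-1
         -- `SignedOrder` takes remainders modulo `α / 2`, so its positivity is made available as an
         -- instance.
         instance α/2≢0 = >-nonZero (IsOrder.positive β-isOrder) in
     SignedOrder.offset⇒Diag (2 * (m / α)) β-isOrder (m≡2*[m/α]*[α/2] 2∣α) j≢i ,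
     SignedOrder.noOffset⇒Θ (2 * (m / α)) β-isOrder (m≡2*[m/α]*[α/2] 2∣α) j≢i)
  where open PacketBlocks m n k α k^m≡1 order
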